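{- Let $q$ be a prime power, $r\ge 1$ an integer, and $\mathcal{S}$ a $q^r$-divisible spanning set of $q^{r+1}$ points in $\mathrm{PG}(v-1,q)$. If $\mathcal{S}$ contains a full affine $(r+1)$-space, i.e. there exist an $(r+1)$-space $L$ and an $r$-space $F\subseteq L$ such that every point of $L$ not contained in $F$ belongs to $\mathcal{S}$, then $\mathcal{S}$ is an $(r+1)$-cylinder.
   Context: $\mathrm{PG}(v-1,q)$ is the projective space of $\mathbb{F}_q^v$; a $k$-space is a $k$-dimensional subspace of $\mathbb{F}_q^v$ (points are $1$-spaces, hyperplanes $(v-1)$-spaces). A set $\mathcal{S}$ of points is spanning if its points span $\mathbb{F}_q^v$, and it is $q^r$-divisible if $|\mathcal{S}\cap H|\equiv|\mathcal{S}|\pmod{q^r}$ for every hyperplane $H$. An $(r+1)$-cylinder is a multiset of $q^{r+1}$ points which arises as the union (counted with multiplicity) of the point sets $L_1\setminus F,\dots,L_q\setminus F$, where $L_1,\dots,L_q$ are $(r+1)$-spaces and $F$ is an $r$-space contained in every $L_i$ ($L_i\setminus F$ denotes the set of points of $L_i$ not in $F$). -}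

module Defs where

open import Algebra.Structures using (IsCommutativeRing)
open import Data.Fin.Base using (Fin)
import Data.Fin.Properties as Fin
open import Data.List.Base using (List; length; filter; allFin)
import Data.List.Membership.Setoid as SetoidMembership
import Data.List.Relation.Unary.Unique.Setoid as SetoidUnique
open import Data.List.Relation.Unary.Any using (Any)
open import Data.Nat.Base using (ℕ; suc; _^_; _≤_; ∣_-_∣)
open import Data.Nat.Divisibility using (_∣_)
open import Data.Nat.Primality using (Prime)
open import Data.Product.Base using (Σ-syntax; ∃; ∃-syntax; _×_; _,_)
open import Data.Vec.Base using (Vec; []; _∷_; replicate; zipWith; map)
import Data.Vec.Properties as Vec
open import Data.Vec.Relation.Unary.All as All using (All; []; _∷_; all?)
open import Function.Bundles using (_↔_; module Inverse)
open import Function.Properties.Inverse using (↔⇒↣)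
open import Level using (0ℓ)
open import Relation.Binary.Bundles using (Setoid)
open import Relation.Binary.Definitions using (DecidableEquality)
open import Relation.Binary.PropositionalEquality
  using (_≡_; _≢_; sym; subst)
open import Relation.Nullary.Decidable using (Dec; map′; _×-dec_; ¬?)
open import Relation.Nullary.Negation using (¬_)
open import Relation.Unary using (Pred; Decidable; _∈_; _⊆_; _≐_)

IsPrimePower : ℕ → Set
IsPrimePower q = ∃[ p ] ∃[ h ] (Prime p × 1 ≤ h × q ≡ p ^ h)

_≡_[mod_] : ℕ → ℕ → ℕ → Set
a ≡ b [mod m ] = m ∣ ∣ a - b ∣

-- A finite set has decidable equality, so no apartness relation is needed
-- (in contrast to Algebra.Apartness.HeytingField).
record FiniteField (q : ℕ) : Set₁ where
  infixl 6 _+_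
  infixl 7 _*_
  infix  8 -_
  field
    Carrier           : Set
    _+_ _*_           : Carrier → Carrier → Carrier
    -_                : Carrier → Carrier
    0# 1#             : Carrier
    isCommutativeRing : IsCommutativeRing _≡_ _+_ _*_ -_ 0# 1#
    0#≢1#             : 0# ≢ 1#
    inverse           : ∀ x → x ≢ 0# → ∃[ y ] x * y ≡ 1#
    enumeration       : Carrier ↔ Fin q

  _≟_ : DecidableEquality Carrier
  _≟_ = Fin.inj⇒≟ (↔⇒↣ enumeration)

  ∃? : ∀ {p} {P : Pred Carrier p} → Decidable P → Dec (∃ P)
  ∃? {P = P} P? = map′
    (λ (i , p) → from i , p)
    (λ (x , p) → to x , subst P (sym (strictlyInverseʳ x)) p)
    (Fin.any? λ i → P? (from i))
    where open Inverse enumeration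

  ∃ⱽ? : ∀ {p n} {P : Pred (Vec Carrier n) p} → Decidable P → Dec (∃ P)
  ∃ⱽ? {n = 0}     P? = map′ ([] ,_) (λ { ([] , p) → p }) (P? [])
  ∃ⱽ? {n = suc n} P? = map′
    (λ (x , xs , p) → x ∷ xs , p)
    (λ { (x ∷ xs , p) → x , xs , p })
    (∃? λ x → ∃ⱽ? λ xs → P? (x ∷ xs))

module ProjectiveSpace {q : ℕ} (F : FiniteField q) (v : ℕ) where
  open FiniteField F

  Vector : Set
  Vector = Vec Carrier v

  infixl 6 _+ⱽ_
  infixl 7 _·ⱽ_

  0ⱽ : Vector
  0ⱽ = replicate v 0#

  _+ⱽ_ : Vector → Vector → Vector
  _+ⱽ_ = zipWith _+_

  _·ⱽ_ : Carrier → Vector → Vector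
  a ·ⱽ x = map (a *_) x

  linearCombination : ∀ {n} → Vec Carrier n → Vec Vector n → Vector
  linearCombination []       []       = 0ⱽ
  linearCombination (a ∷ as) (x ∷ xs) = a ·ⱽ x +ⱽ linearCombination as xs

  LinearlyIndependent : ∀ {n} → Vec Vector n → Set
  LinearlyIndependent {n} xs =
    ∀ as → linearCombination as xs ≡ 0ⱽ → as ≡ replicate n 0#

  Span : ∀ {ℓ} → Pred Vector ℓ → Pred Vector ℓ
  Span X y = ∃[ n ] Σ[ as ∈ Vec Carrier n ] Σ[ xs ∈ Vec Vector n ]
    (All X xs × linearCombination as xs ≡ y)

  record Subspace : Set₁ where
    field
      Member   : Pred Vector 0ℓ
      0-closed : 0ⱽ ∈ Member
      +-closed : ∀ {x y} → x ∈ Member → y ∈ Member → x +ⱽ y ∈ Member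
      ·-closed : ∀ a {x} → x ∈ Member → a ·ⱽ x ∈ Member

  record Basis (k : ℕ) (U : Subspace) : Set where
    open Subspace U
    field
      vectors     : Vec Vector k
      contained   : All Member vectors
      independent : LinearlyIndependent vectors
      spanning    : ∀ {x} → x ∈ Member →
                    ∃[ as ] linearCombination as vectors ≡ x

  -- The chosen basis is data witnessing the dimension; spaces are compared
  -- only through their sets of vectors.
  record Space (k : ℕ) : Set₁ where
    field
      subspace : Subspace
      basis    : Basis k subspace
    open Subspace subspace public
    open Basis basis public

  open Space using (Member)

  infix 4 _⊑_ _≈_ _⊑?_ _≈?_

  _⊑_ : ∀ {k l} → Space k → Space l → Set
  U ⊑ W = Member U ⊆ Member W

  _≈_ : ∀ {k l} → Space k → Space l → Set
  U ≈ W = Member U ≐ Member W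

  linearCombination-closed :
    ∀ {k n} (U : Space k) (as : Vec Carrier n) {xs : Vec Vector n} →
    All (Member U) xs → linearCombination as xs ∈ Member U
  linearCombination-closed U []       []       = Space.0-closed U
  linearCombination-closed U (a ∷ as) (p ∷ ps) =
    Space.+-closed U (Space.·-closed U a p) (linearCombination-closed U as ps)

  member? : ∀ {k} (U : Space k) → Decidable (Member U)
  member? U x = map′
    (λ (as , eq) → subst (Member U) eq
                     (linearCombination-closed U as (Space.contained U)))
    (Space.spanning U)
    (∃ⱽ? λ as → Vec.≡-dec _≟_ (linearCombination as (Space.vectors U)) x)

  _⊑?_ : ∀ {k l} (U : Space k) (W : Space l) → Dec (U ⊑ W)
  U ⊑? W = map′ basis⇒all all⇒basis (all? (member? W) (Space.vectors U))
    where
    basis⇒all : All (Member W) (Space.vectors U) → U ⊑ W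
    basis⇒all ps x∈U with Space.spanning U x∈U
    ... | as , eq = subst (Member W) eq (linearCombination-closed W as ps)

    all⇒basis : U ⊑ W → All (Member W) (Space.vectors U)
    all⇒basis U⊑W = All.map U⊑W (Space.contained U)

  _≈?_ : ∀ {k l} (U : Space k) (W : Space l) → Dec (U ≈ W)
  U ≈? W = (U ⊑? W) ×-dec (W ⊑? U)

  Point : Set₁
  Point = Space 1

  pointSetoid : Setoid _ _
  pointSetoid = record
    { Carrier       = Point
    ; _≈_           = _≈_
    ; isEquivalence = record
      { refl  = (λ p → p) , (λ p → p)
      ; sym   = λ (f , g) → g , f
      ; trans = λ (f , g) (h , k) → (λ p → h (f p)) , (λ p → g (k p))
      }
    }

  open SetoidMembership pointSetoid public using () renaming (_∈_ to _∈ₚ_)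

  -- A finite multiset of points is a list, considered up to the order of its
  -- entries; it is a set when no two entries are equal as subspaces.
  Multiset : Set₁
  Multiset = List Point

  IsSet : Multiset → Set₁
  IsSet = SetoidUnique.Unique pointSetoid

  multiplicity : Multiset → Point → ℕ
  multiplicity S P = length (filter (P ≈?_) S)

  ∣_∩_∣ : ∀ {k} → Multiset → Space k → ℕ
  ∣ S ∩ U ∣ = length (filter (_⊑? U) S)

  Spanning : Multiset → Set₁
  Spanning S = ∀ x → x ∈ Span (λ y → Any (λ P → y ∈ Member P) S)

  Divisible : ℕ → Multiset → Set₁
  Divisible m S =
    ∀ {k} → suc k ≡ v → (H : Space k) → ∣ S ∩ H ∣ ≡ length S [mod m ]

  _∈_∖_ : ∀ {k l} → Point → Space k → Space l → Set
  P ∈ L ∖ K = P ⊑ L × ¬ P ⊑ K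

  _∈?_∖_ : ∀ {k l} (P : Point) (L : Space k) (K : Space l) → Dec (P ∈ L ∖ K)
  P ∈? L ∖ K = (P ⊑? L) ×-dec ¬? (P ⊑? K)

  ContainsAffineSpace : ℕ → Multiset → Set₁
  ContainsAffineSpace r S =
    Σ[ L ∈ Space (suc r) ] Σ[ K ∈ Space r ]
      (K ⊑ L × (∀ P → P ∈ L ∖ K → P ∈ₚ S))

  -- IsCylinder r S says that S is an (r+1)-cylinder. The union with
  -- multiplicity of the sets L i ∖ K contains P as often as there are
  -- indices i with P ∈ L i ∖ K; the L i need not be distinct.
  IsCylinder : ℕ → Multiset → Set₁
  IsCylinder r S =
    length S ≡ q ^ suc r ×
    (Σ[ L ∈ (Fin q → Space (suc r)) ] Σ[ K ∈ Space r ]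
      ((∀ i → K ⊑ L i) ×
       (∀ P → multiplicity S P ≡
              length (filter (λ i → P ∈? L i ∖ K) (allFin q)))))

module Submission where

-- For a functional h write f(h) for the number of points of S in ker h, and
-- K⊥ for the functionals vanishing on K (called F in the informal statement).
-- Counting pairs (h , P) with h ∈ X⊥ and h(P) = 0 gives
--   q Σ_{h ∈ X⊥} f(h) = |X⊥| (|S| + (q − 1) |S ∩ ⟨X⟩|).
-- If h does not vanish on K, then ker h meets L ∖ K, so f(h) > 0 and, by
-- divisibility, f(h) ≥ q^r.  The count for X = ∅ and X = K then leaves no slack:
-- S ∩ K = ∅, and f(h) = q^r for every h outside K⊥.  The count for X = {P}
-- recovers the multiplicity of P from the values of f, and since f is constant
-- off K⊥ this multiplicity depends only on ⟨P , K⟩.  Hence S is a union of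
-- sets ⟨P , K⟩ ∖ K, of q^r points each.

open import Defs
open import Algebra.Bundles using (CommutativeRing)
open import Data.Bool.Base using (true; false; if_then_else_)
open import Data.Empty using (⊥-elim)
open import Data.Fin.Base using (Fin; zero; suc; punchIn)
open import Data.Fin.Properties as Fin using (*↔×; injective⇒≤; punchInᵢ≢i)
open import Data.List.Base as List using (List; []; _∷_; length; filter)
open import Data.List.Membership.Propositional using (find; lose)
open import Data.List.Membership.Propositional.Properties using (∈-filter⁻; ∈-lookup)
open import Data.List.Relation.Unary.All as ListAll using ([]; _∷_)
open import Data.List.Relation.Unary.All.Properties using (filter⁺; All¬⇒¬Any)
open import Data.List.Relation.Unary.Any as ListAny using (Any; here; there)
open import Data.List.Relation.Unary.Any.Properties using (lookup-index)
import Data.List.Relation.Unary.AllPairs as AllPairs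
open import Data.List.Properties
  using (tabulate-lookup; length-filter; filter-none; filter-accept; filter-reject; filter-some)
open import Data.Nat.Base as ℕ using (ℕ; zero; suc; _^_; _≤_; z≤n; s≤s; NonZero)
open import Data.Nat.Divisibility using (_∣_; ∣⇒≤; ∣m+n∣m⇒∣n; n∣m*n)
import Data.Nat.Properties as ℕ
open import Data.Product.Base using (∃; Σ-syntax; _×_; _,_; proj₁; proj₂)
open import Data.Product.Function.NonDependent.Propositional using (_×-↔_)
open import Data.Sum.Base using (_⊎_; inj₁; inj₂)
open import Data.Vec.Base as Vec using (Vec; []; _∷_; replicate; zipWith; map)
import Data.Vec.Properties as Vec
open import Data.Vec.Relation.Unary.All as All using (All; []; _∷_; all?)
open import Function.Base using (_∘_; case_of_)
open import Function.Bundles using (_↔_; module Inverse; mk↔ₛ′)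
open import Function.Properties.Inverse using (↔-sym; ↔-trans)
open import Level using (Level; 0ℓ)
open import Relation.Binary.Bundles using (Setoid)
open import Relation.Binary.PropositionalEquality
  using (_≡_; _≢_; _≗_; refl; sym; trans; cong; cong₂; subst; module ≡-Reasoning)
open import Relation.Nullary.Decidable using (Dec; yes; no; does; ¬?)
open import Relation.Nullary.Negation using (¬_; contradiction)
open import Relation.Unary using (Pred; Decidable; _⊆_; _∈_)
open import Data.Nat.Tactic.RingSolver using () renaming (solve-∀ to solve-∀ℕ)
open import Algebra.Properties.Semiring.Sum ℕ.+-*-semiring

-- Finite sums and counting

-- Why there is no slack: on X⊥, evaluation at a vector outside ⟨X⟩ takes every value equally often,
-- so a point of S adds 1/q to the average of f over X⊥, or 1 if it lies in ⟨X⟩. Since |S| =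
-- q^(r+1), the average over all functionals is exactly q^r, and over K⊥ it is q^r plus a surplus
-- from S ∩ K. A lower bound q^r off K⊥ can therefore be exceeded nowhere, and the surplus must
-- vanish. Functionals replace hyperplanes because X⊥ is then a vector space, which translations
-- permute. The zero functional, whose kernel is no hyperplane, lies in K⊥, where no bound is
-- required. Two points of ⟨x , K⟩ outside K have equal multiplicity because the same functionals of
-- K⊥ vanish at both, namely the annihilator of ⟨x , K⟩. As S is a set, one point of S there forces
-- multiplicity 1 on all of them.

private
  variable
    a : Level
    A : Set a

ind : Dec A → ℕ
ind d = if does d then 1 else 0

ind-yes : (d : Dec A) → A → ind d ≡ 1
ind-yes (yes _) _ = refl
ind-yes (no ¬a) a = contradiction a ¬a

ind-no : (d : Dec A) → ¬ A → ind d ≡ 0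
ind-no (yes a) ¬a = contradiction a ¬a
ind-no (no _)  _  = refl

ind-complement : (d : Dec A) → ind d ℕ.+ ind (¬? d) ≡ 1
ind-complement (yes _) = refl
ind-complement (no _)  = refl

ind-cong : ∀ {a b} {A : Set a} {B : Set b} (d : Dec A) (e : Dec B) →
           (A → B) → (B → A) → ind d ≡ ind e
ind-cong (yes a) e f g = sym (ind-yes e (f a))
ind-cong (no ¬a) e f g = sym (ind-no e (¬a ∘ g))

sum-const : ∀ n c → ∑[ i < n ] c ≡ n ℕ.* c
sum-const zero    c = refl
sum-const (suc n) c = cong (c ℕ.+_) (sum-const n c)

sum-mono-≤ : ∀ {n} {f g : Fin n → ℕ} → (∀ i → f i ≤ g i) → sum f ≤ sum g
sum-mono-≤ {zero}  f≤g = z≤n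
sum-mono-≤ {suc n} f≤g = ℕ.+-mono-≤ (f≤g zero) (sum-mono-≤ (f≤g ∘ suc))

-- A strict inequality in one term would have to be made up in another, which `f≤g` forbids. This
-- turns an equality of totals over all functionals into one at each functional.
sum-mono-≤-tight : ∀ {n} {f g : Fin n → ℕ} → (∀ i → f i ≤ g i) →
                   sum g ≤ sum f → f ≗ g
sum-mono-≤-tight {suc n} {f} {g} f≤g Σg≤Σf zero = ℕ.≤-antisym (f≤g zero)
  (ℕ.+-cancelʳ-≤ (sum (g ∘ suc)) _ _
    (ℕ.≤-trans Σg≤Σf (ℕ.+-monoʳ-≤ (f zero) (sum-mono-≤ (f≤g ∘ suc)))))
sum-mono-≤-tight {suc n} {f} {g} f≤g Σg≤Σf (suc i) =
  sum-mono-≤-tight (f≤g ∘ suc)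
    (ℕ.+-cancelˡ-≤ (f zero) _ _
      (ℕ.≤-trans (ℕ.+-monoˡ-≤ (sum (g ∘ suc)) (f≤g zero)) Σg≤Σf)) i

term≤sum : ∀ {n} (f : Fin n → ℕ) i → f i ≤ sum f
term≤sum f zero    = ℕ.m≤m+n _ _
term≤sum f (suc i) = ℕ.≤-trans (term≤sum (f ∘ suc) i) (ℕ.m≤n+m _ (f zero))

sum-zero : ∀ {n} {f : Fin n → ℕ} → (∀ i → f i ≡ 0) → sum f ≡ 0
sum-zero {n} f≡0 = trans (sum-cong-≗ f≡0) (sum-replicate-zero n)

sum-ind-unique : ∀ {n p} {P : Pred (Fin n) p} (P? : Decidable P) (i : Fin n) →
                 P i → (∀ j → P j → j ≡ i) → ∑[ j < n ] ind (P? j) ≡ 1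
sum-ind-unique {suc n} P? i Pi unique = begin
  sum (ind ∘ P?)                                ≡⟨ sum-remove {i = i} (ind ∘ P?) ⟩
  ind (P? i) ℕ.+ sum (ind ∘ P? ∘ punchIn i)     ≡⟨ cong₂ ℕ._+_ (ind-yes (P? i) Pi)
                                                     (sum-zero λ j → ind-no (P? (punchIn i j))
                                                       (punchInᵢ≢i i j ∘ unique _)) ⟩
  1                                             ∎
  where open ≡-Reasoning

length-filter-tabulate : ∀ {a p} {A : Set a} {P : Pred A p} (P? : Decidable P) →
  ∀ {n} (f : Fin n → A) →
  length (filter P? (List.tabulate f)) ≡ ∑[ i < n ] ind (P? (f i))
length-filter-tabulate P? {zero}  f = refl
length-filter-tabulate P? {suc n} f with does (P? (f zero))
... | true  = cong suc (length-filter-tabulate P? (f ∘ suc))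
... | false = length-filter-tabulate P? (f ∘ suc)

length-filter-lookup : ∀ {a p} {A : Set a} {P : Pred A p} (P? : Decidable P) xs →
  length (filter P? xs) ≡ ∑[ i < length xs ] ind (P? (List.lookup xs i))
length-filter-lookup P? xs = trans
  (cong (length ∘ filter P?) (sym (tabulate-lookup xs)))
  (length-filter-tabulate P? (List.lookup xs))

module _ {a p r} {A : Set a} {P : Pred A p} {R : Pred A r}
         (P? : Decidable P) (R? : Decidable R) where

  length-filter-filter-⊆ : P ⊆ R → ∀ xs →
    length (filter P? (filter R? xs)) ≡ length (filter P? xs)
  length-filter-filter-⊆ P⊆R []       = refl
  length-filter-filter-⊆ P⊆R (x ∷ xs) with R? x | P? x in eq
  ... | yes _ | yes _ rewrite eq = cong suc (length-filter-filter-⊆ P⊆R xs)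
  ... | yes _ | no _  rewrite eq = length-filter-filter-⊆ P⊆R xs
  ... | no ¬r | yes p = contradiction (P⊆R p) ¬r
  ... | no _  | no _  = length-filter-filter-⊆ P⊆R xs

  length-filter-filter-disjoint : (∀ {x} → P x → ¬ R x) → ∀ xs →
    length (filter P? (filter R? xs)) ≡ 0
  length-filter-filter-disjoint P∩R []       = refl
  length-filter-filter-disjoint P∩R (x ∷ xs) with R? x | P? x in eq
  ... | yes r | yes p = contradiction r (P∩R p)
  ... | yes _ | no _  rewrite eq = length-filter-filter-disjoint P∩R xs
  ... | no _  | _     = length-filter-filter-disjoint P∩R xs

length-filter-complement : ∀ {a p} {A : Set a} {P : Pred A p} (P? : Decidable P) xs →
  length xs ≡ length (filter P? xs) ℕ.+ length (filter (¬? ∘ P?) xs)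
length-filter-complement P? []       = refl
length-filter-complement P? (x ∷ xs) with P? x
... | yes _ = cong suc (length-filter-complement P? xs)
... | no _  = trans (cong suc (length-filter-complement P? xs)) (sym (ℕ.+-suc _ _))

module _ {a} {A : Set a} {m : ℕ} (e : A ↔ Fin m) where
  open Inverse e

  sumOver : (A → ℕ) → ℕ
  sumOver φ = ∑[ i < m ] φ (from i)

  sumOver-cong : ∀ {φ ψ} → φ ≗ ψ → sumOver φ ≡ sumOver ψ
  sumOver-cong φ≗ψ = sum-cong-≗ (φ≗ψ ∘ from)

  sumOver-bijection : (π : A ↔ A) (φ : A → ℕ) →
                      sumOver φ ≡ sumOver (φ ∘ Inverse.to π)
  sumOver-bijection π φ = trans
    (sum-permute (φ ∘ from) (↔-trans (↔-sym e) (↔-trans π e)))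
    (sum-cong-≗ {m} λ i → cong φ (strictlyInverseʳ (Inverse.to π (from i))))

  sumOver-ind-unique : ∀ {p} {P : Pred A p} (P? : Decidable P) (x : A) →
    P x → (∀ y → P y → y ≡ x) → sumOver (ind ∘ P?) ≡ 1
  sumOver-ind-unique {P = P} P? x Px unique = sum-ind-unique (P? ∘ from) (to x)
    (subst P (sym (strictlyInverseʳ x)) Px)
    (λ j Pj → trans (sym (strictlyInverseˡ j)) (cong to (unique _ Pj)))

  term≤sumOver : (φ : A → ℕ) (x : A) → φ x ≤ sumOver φ
  term≤sumOver φ x = subst (_≤ sumOver φ) (cong φ (strictlyInverseʳ x))
    (term≤sum (φ ∘ from) (to x))

-- Linear algebra over a finite field

module LinearAlgebra {q : ℕ} (F : FiniteField q) where
  open FiniteField F renaming (_≟_ to infix 4 _≟_)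
  open module V {n : ℕ} = ProjectiveSpace F n
    using (Vector; 0ⱽ; _+ⱽ_; _·ⱽ_; linearCombination; LinearlyIndependent)

  commutativeRing : CommutativeRing 0ℓ 0ℓ
  commutativeRing = record { isCommutativeRing = isCommutativeRing }

  open CommutativeRing commutativeRing
    using (+-assoc; +-comm; +-identityˡ; +-identityʳ; *-comm; *-identityˡ; *-identityʳ;
           zeroˡ; zeroʳ; -‿inverseˡ; -‿inverseʳ; *-assoc)

  open import Algebra.Properties.Ring (CommutativeRing.ring commutativeRing)
    using (-‿distribˡ-*; -‿distribʳ-*; +-inverseʳ-unique)
  open import Algebra.Solver.Ring.NaturalCoefficients.Default
    (CommutativeRing.commutativeSemiring commutativeRing)
    using (solve; _:=_; _:+_; _:*_; con)

  private
    variable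
      n k : ℕ

  -- Pairing of functionals and vectors

  infixl 9 _∙_

  -- The standard pairing identifies functionals with vectors, so that sums over functionals are
  -- sums over `Vec Carrier n`.
  _∙_ : Vec Carrier n → Vec Carrier n → Carrier
  []      ∙ []      = 0#
  (a ∷ h) ∙ (b ∷ x) = a * b + h ∙ x

  ∙-comm : (x y : Vec Carrier n) → x ∙ y ≡ y ∙ x
  ∙-comm []      []      = refl
  ∙-comm (a ∷ x) (b ∷ y) = cong₂ _+_ (*-comm a b) (∙-comm x y)

  ∙-+ʳ : (h x y : Vec Carrier n) → h ∙ (x +ⱽ y) ≡ h ∙ x + h ∙ y
  ∙-+ʳ []      []      []      = sym (+-identityˡ 0#)
  ∙-+ʳ (a ∷ h) (b ∷ x) (c ∷ y) = trans (cong (a * (b + c) +_) (∙-+ʳ h x y))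
    (solve 5 (λ a b c s t → a :* (b :+ c) :+ (s :+ t) := a :* b :+ s :+ (a :* c :+ t))
      refl a b c (h ∙ x) (h ∙ y))

  ∙-·ʳ : (h : Vec Carrier n) (c : Carrier) (x : Vec Carrier n) → h ∙ (c ·ⱽ x) ≡ c * h ∙ x
  ∙-·ʳ []      c []      = sym (zeroʳ c)
  ∙-·ʳ (a ∷ h) c (b ∷ x) = trans (cong (a * (c * b) +_) (∙-·ʳ h c x))
    (solve 4 (λ a b c s → a :* (c :* b) :+ c :* s := c :* (a :* b :+ s))
      refl a b c (h ∙ x))

  ∙-+ˡ : (g h x : Vec Carrier n) → (g +ⱽ h) ∙ x ≡ g ∙ x + h ∙ x
  ∙-+ˡ g h x = trans (∙-comm (g +ⱽ h) x)
    (trans (∙-+ʳ x g h) (cong₂ _+_ (∙-comm x g) (∙-comm x h)))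

  ∙-·ˡ : (c : Carrier) (h x : Vec Carrier n) → (c ·ⱽ h) ∙ x ≡ c * h ∙ x
  ∙-·ˡ c h x = trans (∙-comm (c ·ⱽ h) x) (trans (∙-·ʳ x c h) (cong (c *_) (∙-comm x h)))

  ∙-zeroʳ : (h : Vec Carrier n) → h ∙ 0ⱽ ≡ 0#
  ∙-zeroʳ []      = refl
  ∙-zeroʳ (a ∷ h) = trans (cong₂ _+_ (zeroʳ a) (∙-zeroʳ h)) (+-identityˡ 0#)

  ∙-zeroˡ : (x : Vec Carrier n) → 0ⱽ ∙ x ≡ 0#
  ∙-zeroˡ x = trans (∙-comm 0ⱽ x) (∙-zeroʳ x)

  +ⱽ-identityˡ : (x : Vec Carrier n) → 0ⱽ +ⱽ x ≡ x
  +ⱽ-identityˡ []      = refl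
  +ⱽ-identityˡ (a ∷ x) = cong₂ _∷_ (+-identityˡ a) (+ⱽ-identityˡ x)

  +ⱽ-identityʳ : (x : Vec Carrier n) → x +ⱽ 0ⱽ ≡ x
  +ⱽ-identityʳ []      = refl
  +ⱽ-identityʳ (a ∷ x) = cong₂ _∷_ (+-identityʳ a) (+ⱽ-identityʳ x)

  ·ⱽ-identityˡ : (x : Vec Carrier n) → 1# ·ⱽ x ≡ x
  ·ⱽ-identityˡ []      = refl
  ·ⱽ-identityˡ (a ∷ x) = cong₂ _∷_ (*-identityˡ a) (·ⱽ-identityˡ x)

  ·ⱽ-zeroˡ : (x : Vec Carrier n) → 0# ·ⱽ x ≡ 0ⱽ
  ·ⱽ-zeroˡ []      = refl
  ·ⱽ-zeroˡ (a ∷ x) = cong₂ _∷_ (zeroˡ a) (·ⱽ-zeroˡ x)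

  ·ⱽ-zeroʳ : (c : Carrier) → c ·ⱽ 0ⱽ {n} ≡ 0ⱽ
  ·ⱽ-zeroʳ {zero}  c = refl
  ·ⱽ-zeroʳ {suc n} c = cong₂ _∷_ (zeroʳ c) (·ⱽ-zeroʳ c)

  ·ⱽ-assoc : (a b : Carrier) (x : Vec Carrier n) → a ·ⱽ (b ·ⱽ x) ≡ (a * b) ·ⱽ x
  ·ⱽ-assoc a b []      = refl
  ·ⱽ-assoc a b (c ∷ x) = cong₂ _∷_ (sym (*-assoc a b c)) (·ⱽ-assoc a b x)

  ·ⱽ-distrib-combination : (c a : Carrier) (x y : Vec Carrier n) →
    c ·ⱽ (a ·ⱽ x +ⱽ y) ≡ (c * a) ·ⱽ x +ⱽ c ·ⱽ y
  ·ⱽ-distrib-combination c a []      []      = refl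
  ·ⱽ-distrib-combination c a (b ∷ x) (d ∷ y) = cong₂ _∷_
    (solve 4 (λ c a b d → c :* (a :* b :+ d) := c :* a :* b :+ c :* d) refl c a b d)
    (·ⱽ-distrib-combination c a x y)

  +ⱽ-combination : (a b : Carrier) (x y z : Vec Carrier n) →
    (a ·ⱽ x +ⱽ y) +ⱽ (b ·ⱽ x +ⱽ z) ≡ (a + b) ·ⱽ x +ⱽ (y +ⱽ z)
  +ⱽ-combination a b []      []      []      = refl
  +ⱽ-combination a b (c ∷ x) (d ∷ y) (e ∷ z) = cong₂ _∷_
    (solve 5 (λ a b c d e → (a :* c :+ d) :+ (b :* c :+ e) := (a :+ b) :* c :+ (d :+ e))
      refl a b c d e)
    (+ⱽ-combination a b x y z)

  -- Negatives are kept out of the semiring identities: c′ plays the part of − c.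
  ·ⱽ-cancel : ∀ {c c′} → c + c′ ≡ 0# → (x y : Vec Carrier n) →
              c ·ⱽ x +ⱽ (y +ⱽ c′ ·ⱽ x) ≡ y
  ·ⱽ-cancel c+c′≡0 []      []      = refl
  ·ⱽ-cancel {c = c} {c′} c+c′≡0 (a ∷ x) (b ∷ y) = cong₂ _∷_
    (trans
      (solve 4 (λ a b c c′ → c :* a :+ (b :+ c′ :* a) := b :+ (c :+ c′) :* a) refl a b c c′)
      (trans (cong (λ z → b + z * a) c+c′≡0)
             (trans (cong (b +_) (zeroˡ a)) (+-identityʳ b))))
    (·ⱽ-cancel c+c′≡0 x y)

  +ⱽ-cancelˡ : (x y z : Vec Carrier n) → x +ⱽ y ≡ x +ⱽ z → y ≡ z
  +ⱽ-cancelˡ x y z eq = trans (lemma y) (trans (cong (_+ⱽ - 1# ·ⱽ x) eq) (sym (lemma z)))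
    where
    lemma : ∀ u → u ≡ (x +ⱽ u) +ⱽ - 1# ·ⱽ x
    lemma u = sym (trans (trans (Vec.zipWith-assoc +-assoc x u _)
      (cong (_+ⱽ (u +ⱽ - 1# ·ⱽ x)) (sym (·ⱽ-identityˡ x))))
      (·ⱽ-cancel (-‿inverseʳ 1#) x u))

  linearCombination-+ : (as bs : Vec Carrier k) (xs : Vec (Vec Carrier n) k) →
    linearCombination (as +ⱽ bs) xs ≡ linearCombination as xs +ⱽ linearCombination bs xs
  linearCombination-+ []       []       []       = sym (+ⱽ-identityˡ 0ⱽ)
  linearCombination-+ (a ∷ as) (b ∷ bs) (x ∷ xs) = trans
    (cong ((a + b) ·ⱽ x +ⱽ_) (linearCombination-+ as bs xs))
    (sym (+ⱽ-combination a b x _ _))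

  linearCombination-· : (c : Carrier) (as : Vec Carrier k) (xs : Vec (Vec Carrier n) k) →
    linearCombination (c ·ⱽ as) xs ≡ c ·ⱽ linearCombination as xs
  linearCombination-· c []       []       = sym (·ⱽ-zeroʳ c)
  linearCombination-· c (a ∷ as) (x ∷ xs) = trans
    (cong ((c * a) ·ⱽ x +ⱽ_) (linearCombination-· c as xs))
    (sym (·ⱽ-distrib-combination c a x _))

  linearCombination-0 : (xs : Vec (Vec Carrier n) k) → linearCombination 0ⱽ xs ≡ 0ⱽ
  linearCombination-0 []       = refl
  linearCombination-0 (x ∷ xs) = trans
    (cong₂ _+ⱽ_ (·ⱽ-zeroˡ x) (linearCombination-0 xs)) (+ⱽ-identityˡ 0ⱽ)

  linearCombination-injective : (xs : Vec (Vec Carrier n) k) → LinearlyIndependent xs →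
    ∀ as bs → linearCombination as xs ≡ linearCombination bs xs → as ≡ bs
  linearCombination-injective xs independent as bs eq = trans
    (sym (·ⱽ-cancel 1-1 bs as))
    (trans (cong (1# ·ⱽ bs +ⱽ_)
             (independent _ (trans (linearCombination-+ as _ xs)
               (trans (cong₂ _+ⱽ_ eq (linearCombination-· (- 1#) bs xs))
                      cancel))))
           (trans (+ⱽ-identityʳ _) (·ⱽ-identityˡ bs)))
    where
    1-1 = -‿inverseʳ 1#
    y = linearCombination bs xs
    cancel : y +ⱽ - 1# ·ⱽ y ≡ 0ⱽ
    cancel = trans (cong₂ _+ⱽ_ (sym (·ⱽ-identityˡ y)) (sym (+ⱽ-identityˡ _)))
                   (·ⱽ-cancel 1-1 y 0ⱽ)

  -- Annihilators, spans and separation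

  infix 4 _⊥_ _⊥?_

  _⊥_ : Vec Carrier n → Vec (Vec Carrier n) k → Set
  h ⊥ xs = All (λ x → h ∙ x ≡ 0#) xs

  _⊥?_ : (h : Vec Carrier n) (xs : Vec (Vec Carrier n) k) → Dec (h ⊥ xs)
  h ⊥? xs = all? (λ x → h ∙ x ≟ 0#) xs

  InSpan : Vec (Vec Carrier n) k → Vec Carrier n → Set
  InSpan xs x = ∃ λ as → linearCombination as xs ≡ x

  inSpan? : (xs : Vec (Vec Carrier n) k) → Decidable (InSpan xs)
  inSpan? xs x = ∃ⱽ? λ as → Vec.≡-dec _≟_ (linearCombination as xs) x

  ⊥-span : {h : Vec Carrier n} {xs : Vec (Vec Carrier n) k} → h ⊥ xs →
           ∀ {x} → InSpan xs x → h ∙ x ≡ 0#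
  ⊥-span {h = h} []           ([]     , refl) = ∙-zeroʳ h
  ⊥-span {h = h} {x ∷ xs} (p ∷ ps) (a ∷ as , refl) = begin
    h ∙ (a ·ⱽ x +ⱽ linearCombination as xs)       ≡⟨ ∙-+ʳ h _ _ ⟩
    h ∙ (a ·ⱽ x) + h ∙ linearCombination as xs    ≡⟨ cong₂ _+_ (∙-·ʳ h a x) (⊥-span {h = h} ps (as , refl)) ⟩
    a * h ∙ x + 0#                                ≡⟨ +-identityʳ _ ⟩
    a * h ∙ x                                     ≡⟨ cong (a *_) p ⟩
    a * 0#                                        ≡⟨ zeroʳ a ⟩
    0#                                            ∎
    where open ≡-Reasoning

  dual-vector : (x : Vec Carrier n) → x ≡ 0ⱽ ⊎ ∃ λ w → w ∙ x ≡ 1#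
  dual-vector []      = inj₁ refl
  dual-vector (a ∷ x) with a ≟ 0#
  ... | no a≢0 with b , ab≡1 ← inverse a a≢0 =
    inj₂ (b ∷ 0ⱽ , trans (cong₂ _+_ (trans (*-comm b a) ab≡1) (∙-zeroˡ x)) (+-identityʳ 1#))
  ... | yes refl with dual-vector x
  ...   | inj₁ refl      = inj₁ refl
  ...   | inj₂ (w , wx≡1) =
    inj₂ (0# ∷ w , trans (cong₂ _+_ (zeroˡ 0#) wx≡1) (+-identityˡ 1#))

  separation : (xs : Vec (Vec Carrier n) k) (y : Vec Carrier n) →
               InSpan xs y ⊎ ∃ λ w → w ⊥ xs × w ∙ y ≡ 1#
  separation []       y with dual-vector y
  ... | inj₁ refl        = inj₁ ([] , refl)
  ... | inj₂ (w , wy≡1) = inj₂ (w , [] , wy≡1)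
  separation (x ∷ xs) y with separation xs x
  ... | inj₁ x∈xs with separation xs y
  ...   | inj₁ (as , refl)     = inj₁ (0# ∷ as , trans (cong (_+ⱽ _) (·ⱽ-zeroˡ x)) (+ⱽ-identityˡ _))
  ...   | inj₂ (w , w⊥ , wy≡1) = inj₂ (w , ⊥-span {h = w} w⊥ x∈xs ∷ w⊥ , wy≡1)
  separation (x ∷ xs) y | inj₂ (w , w⊥xs , wx≡1)
    with separation xs (y +ⱽ - (w ∙ y) ·ⱽ x)
  ... | inj₁ (as , eq) = inj₁ (w ∙ y ∷ as , trans (cong (_ +ⱽ_) eq) (·ⱽ-cancel (-‿inverseʳ _) x y))
  ... | inj₂ (u , u⊥xs , eq) = inj₂ (t , tx≡0 ∷ t⊥xs , ty≡1)
    where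
    open ≡-Reasoning
    -- `t` is `u` composed with the projection z ↦ z - (w ∙ z) x, which kills `x` and fixes `xs`.
    t = u +ⱽ - (u ∙ x) ·ⱽ w

    t∙ : ∀ z → t ∙ z ≡ u ∙ z + - (u ∙ x) * w ∙ z
    t∙ z = trans (∙-+ˡ u _ z) (cong (u ∙ z +_) (∙-·ˡ _ w z))

    tx≡0 : t ∙ x ≡ 0#
    tx≡0 = begin
      t ∙ x                            ≡⟨ t∙ x ⟩
      u ∙ x + - (u ∙ x) * w ∙ x        ≡⟨ cong (λ c → u ∙ x + - (u ∙ x) * c) wx≡1 ⟩
      u ∙ x + - (u ∙ x) * 1#           ≡⟨ cong (u ∙ x +_) (*-identityʳ _) ⟩
      u ∙ x + - (u ∙ x)                ≡⟨ -‿inverseʳ _ ⟩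
      0#                               ∎

    t⊥xs : t ⊥ xs
    t⊥xs = All.map (λ {z} (uz≡0 , wz≡0) → trans (t∙ z)
      (trans (cong₂ (λ a b → a + - (u ∙ x) * b) uz≡0 wz≡0)
             (trans (+-identityˡ _) (zeroʳ _)))) (All.zip (u⊥xs , w⊥xs))

    ty≡1 : t ∙ y ≡ 1#
    ty≡1 = begin
      t ∙ y                            ≡⟨ t∙ y ⟩
      u ∙ y + - (u ∙ x) * w ∙ y        ≡⟨ cong (u ∙ y +_) swap ⟩
      u ∙ y + - (w ∙ y) * u ∙ x        ≡⟨ cong (u ∙ y +_) (∙-·ʳ u _ x) ⟨
      u ∙ y + u ∙ (- (w ∙ y) ·ⱽ x)     ≡⟨ ∙-+ʳ u y _ ⟨
      u ∙ (y +ⱽ - (w ∙ y) ·ⱽ x)        ≡⟨ eq ⟩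
      1#                               ∎
      where
      swap : - (u ∙ x) * w ∙ y ≡ - (w ∙ y) * u ∙ x
      swap = trans (sym (-‿distribˡ-* _ _))
        (trans (cong -_ (*-comm _ _)) (-‿distribˡ-* _ _))

  vectors↔Fin : ∀ n → Vec Carrier n ↔ Fin (q ^ n)
  vectors↔Fin zero    = mk↔ₛ′ (λ _ → zero) (λ _ → []) (λ { zero → refl }) (λ { [] → refl })
  vectors↔Fin (suc n) = ↔-trans uncons (↔-trans (enumeration ×-↔ vectors↔Fin n) (↔-sym *↔×))
    where
    uncons : Vec Carrier (suc n) ↔ (Carrier × Vec Carrier n)
    uncons = mk↔ₛ′ (λ x → Vec.head x , Vec.tail x) (λ (a , x) → a ∷ x)
                   (λ _ → refl) (λ { (_ ∷ _) → refl })

  translation : (w : Vec Carrier n) → Vec Carrier n ↔ Vec Carrier n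
  translation w = mk↔ₛ′ (_+ⱽ w) (_+ⱽ - 1# ·ⱽ w) inv₁ inv₂
    where
    w⁻ = - 1# ·ⱽ w

    cancel : ∀ x → w +ⱽ (x +ⱽ w⁻) ≡ x
    cancel x = trans (cong (_+ⱽ (x +ⱽ w⁻)) (sym (·ⱽ-identityˡ w)))
                     (·ⱽ-cancel (-‿inverseʳ 1#) w x)

    inv₁ : ∀ x → (x +ⱽ w⁻) +ⱽ w ≡ x
    inv₁ x = trans (Vec.zipWith-comm +-comm _ w) (cancel x)

    inv₂ : ∀ x → (x +ⱽ w) +ⱽ w⁻ ≡ x
    inv₂ x = trans (cong (_+ⱽ w⁻) (Vec.zipWith-comm +-comm x w))
      (trans (Vec.zipWith-assoc +-assoc w x w⁻) (cancel x))

  -- Counting linear functionals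

  ∑ⱽ : (Vec Carrier n → ℕ) → ℕ
  ∑ⱽ {n} = sumOver (vectors↔Fin n)

  -- This is q to the power n - rank, but the value is never computed: positivity, additivity and
  -- ratios suffice.
  ⊥-count : Vec (Vec Carrier n) k → ℕ
  ⊥-count xs = ∑ⱽ λ h → ind (h ⊥? xs)

  -- Makes `q⁻` cancellable, which isolates the number of points in a span, and makes the powers of
  -- q strictly increasing, which compares dimensions.
  2≤q : 2 ≤ q
  2≤q = distinct⇒2≤ (0#≢1# ∘ λ eq → trans (sym (strictlyInverseʳ 0#))
                       (trans (cong from eq) (strictlyInverseʳ 1#)))
    where
    open Inverse enumeration
    distinct⇒2≤ : ∀ {m} {i j : Fin m} → i ≢ j → 2 ≤ m
    distinct⇒2≤ {suc zero}    {zero} {zero} i≢j = contradiction refl i≢j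
    distinct⇒2≤ {suc (suc m)}               i≢j = s≤s (s≤s z≤n)

  q⁻ : ℕ
  q⁻ = ℕ.pred q

  q≡1+q⁻ : q ≡ suc q⁻
  q≡1+q⁻ = sym (ℕ.suc-pred q {{ℕ.>-nonZero (ℕ.≤-trans (s≤s z≤n) 2≤q)}})

  instance
    q-nonZero : NonZero q
    q-nonZero = ℕ.>-nonZero (ℕ.≤-trans (s≤s z≤n) 2≤q)

    q⁻-nonZero : NonZero q⁻
    q⁻-nonZero = ℕ.>-nonZero (ℕ.pred-mono-≤ 2≤q)

  ⊥-count-nonZero : (xs : Vec (Vec Carrier n) k) → NonZero (⊥-count xs)
  ⊥-count-nonZero xs = ℕ.>-nonZero (subst (_≤ ⊥-count xs)
    (ind-yes (0ⱽ ⊥? xs) (All.universal ∙-zeroˡ xs))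
    (term≤sumOver (vectors↔Fin _) (λ h → ind (h ⊥? xs)) 0ⱽ))

  module _ (xs : Vec (Vec Carrier n) k) (y : Vec Carrier n) where

    private
      φ : Vec Carrier n → ℕ
      φ h = ind (h ⊥? xs) ℕ.* ind (h ∙ y ≟ 0#)

    -- Translation by the multiples of w permutes the functionals vanishing on
    -- xs and runs through all values at y.
    ⊥-count-hyperplane : (w : Vec Carrier n) → w ⊥ xs → w ∙ y ≡ 1# →
                         q ℕ.* ∑ⱽ φ ≡ ⊥-count xs
    ⊥-count-hyperplane w w⊥xs wy≡1 = begin
      q ℕ.* ∑ⱽ φ                                    ≡⟨ sum-const q (∑ⱽ φ) ⟨
      ∑[ c < q ] ∑ⱽ φ
        ≡⟨ sum-cong-≗ (λ c → sumOver-bijection (vectors↔Fin n) (translation (from c ·ⱽ w)) φ) ⟩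
      ∑[ c < q ] ∑ⱽ (λ h → φ (h +ⱽ from c ·ⱽ w))    ≡⟨ ∑-comm {q} {q ^ n} _ ⟩
      ∑ⱽ (λ h → ∑[ c < q ] φ (h +ⱽ from c ·ⱽ w))    ≡⟨ sumOver-cong (vectors↔Fin n) inner ⟩
      ⊥-count xs                                    ∎
      where
      open ≡-Reasoning
      open Inverse enumeration using (from)

      shift : ∀ h c x → (h +ⱽ c ·ⱽ w) ∙ x ≡ h ∙ x + c * w ∙ x
      shift h c x = trans (∙-+ˡ h _ x) (cong (h ∙ x +_) (∙-·ˡ c w x))

      shift-⊥ : ∀ h c {x} → w ∙ x ≡ 0# → (h +ⱽ c ·ⱽ w) ∙ x ≡ h ∙ x
      shift-⊥ h c {x} wx≡0 = trans (shift h c x)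
        (trans (cong (λ z → h ∙ x + c * z) wx≡0)
               (trans (cong (h ∙ x +_) (zeroʳ c)) (+-identityʳ _)))

      shift-y : ∀ h c → (h +ⱽ c ·ⱽ w) ∙ y ≡ h ∙ y + c
      shift-y h c = trans (shift h c y)
        (cong (h ∙ y +_) (trans (cong (c *_) wy≡1) (*-identityʳ c)))

      inner : ∀ h → ∑[ c < q ] φ (h +ⱽ from c ·ⱽ w) ≡ ind (h ⊥? xs)
      inner h = begin
        ∑[ c < q ] φ (h +ⱽ from c ·ⱽ w)
          ≡⟨ sum-cong-≗ (λ c → cong₂ ℕ._*_
               (ind-cong ((h +ⱽ from c ·ⱽ w) ⊥? xs) (h ⊥? xs)
                 (λ p → All.map (λ (wx , hx) → trans (sym (shift-⊥ h (from c) wx)) hx) (All.zip (w⊥xs , p)))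
                 (λ p → All.map (λ (wx , hx) → trans (shift-⊥ h (from c) wx) hx) (All.zip (w⊥xs , p))))
               (ind-cong ((h +ⱽ from c ·ⱽ w) ∙ y ≟ 0#) (h ∙ y + from c ≟ 0#)
                 (trans (sym (shift-y h (from c)))) (trans (shift-y h (from c))))) ⟩
        ∑[ c < q ] (ind (h ⊥? xs) ℕ.* ind (h ∙ y + from c ≟ 0#))
          ≡⟨ *-distribˡ-sum (ind (h ⊥? xs)) (λ c → ind (h ∙ y + from c ≟ 0#)) ⟨
        ind (h ⊥? xs) ℕ.* sumOver enumeration (λ c → ind (h ∙ y + c ≟ 0#))
          ≡⟨ cong (ind (h ⊥? xs) ℕ.*_) (sumOver-ind-unique enumeration (λ c → h ∙ y + c ≟ 0#)
               (- (h ∙ y)) (-‿inverseʳ _) (λ c eq → +-inverseʳ-unique (h ∙ y) c eq)) ⟩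
        ind (h ⊥? xs) ℕ.* 1
          ≡⟨ ℕ.*-identityʳ _ ⟩
        ind (h ⊥? xs) ∎

    -- The last factor is q or 1. If `y` is in the span, vanishing at `y` is automatic on the
    -- annihilator of `xs`; if not, `separation` supplies the direction of translation for
    -- `⊥-count-hyperplane`. The factor q on the left avoids division.
    ⊥-count-∧ : q ℕ.* ∑ⱽ φ ≡ ⊥-count xs ℕ.* (1 ℕ.+ q⁻ ℕ.* ind (inSpan? xs y))
    ⊥-count-∧ with separation xs y
    ... | inj₁ y∈xs = begin
      q ℕ.* ∑ⱽ φ
        ≡⟨ cong (q ℕ.*_) (sumOver-cong (vectors↔Fin n) φ≡) ⟩
      q ℕ.* ⊥-count xs                                        ≡⟨ ℕ.*-comm q _ ⟩
      ⊥-count xs ℕ.* q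
        ≡⟨ cong (⊥-count xs ℕ.*_) (trans q≡1+q⁻ (cong suc (sym (ℕ.*-identityʳ q⁻)))) ⟩
      ⊥-count xs ℕ.* (1 ℕ.+ q⁻ ℕ.* 1)
        ≡⟨ cong (λ i → ⊥-count xs ℕ.* (1 ℕ.+ q⁻ ℕ.* i)) (ind-yes (inSpan? xs y) y∈xs) ⟨
      ⊥-count xs ℕ.* (1 ℕ.+ q⁻ ℕ.* ind (inSpan? xs y))        ∎
      where
      open ≡-Reasoning
      φ≡ : ∀ h → φ h ≡ ind (h ⊥? xs)
      φ≡ h with h ⊥? xs
      ... | yes h⊥xs = trans (ℕ.*-identityˡ _) (ind-yes (h ∙ y ≟ 0#) (⊥-span {h = h} h⊥xs y∈xs))
      ... | no _     = refl
    ... | inj₂ (w , w⊥xs , wy≡1) = begin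
      q ℕ.* ∑ⱽ φ                                              ≡⟨ ⊥-count-hyperplane w w⊥xs wy≡1 ⟩
      ⊥-count xs                                              ≡⟨ ℕ.*-identityʳ _ ⟨
      ⊥-count xs ℕ.* 1
        ≡⟨ cong (⊥-count xs ℕ.*_) (cong suc (sym (ℕ.*-zeroʳ q⁻))) ⟩
      ⊥-count xs ℕ.* (1 ℕ.+ q⁻ ℕ.* 0)
        ≡⟨ cong (λ i → ⊥-count xs ℕ.* (1 ℕ.+ q⁻ ℕ.* i)) (ind-no (inSpan? xs y) y∉xs) ⟨
      ⊥-count xs ℕ.* (1 ℕ.+ q⁻ ℕ.* ind (inSpan? xs y))        ∎
      where
      open ≡-Reasoning
      y∉xs : ¬ InSpan xs y
      y∉xs y∈xs = 0#≢1# (trans (sym (⊥-span {h = w} w⊥xs y∈xs)) wy≡1)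

  -- Double counting of functionals against a family of vectors

  module _ {m : ℕ} (y : Fin m → Vec Carrier n) where

    -- The f of the overview, with the points given by generating vectors.
    incidence : Vec Carrier n → ℕ
    incidence h = ∑[ i < m ] ind (h ∙ y i ≟ 0#)

    spanCount : Vec (Vec Carrier n) k → ℕ
    spanCount xs = ∑[ i < m ] ind (inSpan? xs (y i))

    -- Exchange the two sums and apply `⊥-count-∧` to each vector: the constant terms add up to `m`,
    -- the indicators to `spanCount xs`.
    ∑-incidence : (xs : Vec (Vec Carrier n) k) →
      q ℕ.* ∑ⱽ (λ h → ind (h ⊥? xs) ℕ.* incidence h) ≡
      ⊥-count xs ℕ.* (m ℕ.+ q⁻ ℕ.* spanCount xs)
    ∑-incidence xs = begin
      q ℕ.* ∑ⱽ (λ h → ind (h ⊥? xs) ℕ.* incidence h)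
        ≡⟨ cong (q ℕ.*_) (sumOver-cong (vectors↔Fin n) λ h →
             *-distribˡ-sum {m} (ind (h ⊥? xs)) (λ i → ind (h ∙ y i ≟ 0#))) ⟩
      q ℕ.* ∑ⱽ (λ h → ∑[ i < m ] φ i h)
        ≡⟨ cong (q ℕ.*_) (∑-comm {q ^ n} {m} _) ⟩
      q ℕ.* ∑[ i < m ] ∑ⱽ (φ i)
        ≡⟨ *-distribˡ-sum {m} q _ ⟩
      ∑[ i < m ] (q ℕ.* ∑ⱽ (φ i))
        ≡⟨ sum-cong-≗ (λ i → ⊥-count-∧ xs (y i)) ⟩
      ∑[ i < m ] (⊥-count xs ℕ.* (1 ℕ.+ q⁻ ℕ.* ind (inSpan? xs (y i))))
        ≡⟨ *-distribˡ-sum {m} (⊥-count xs) _ ⟨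
      ⊥-count xs ℕ.* ∑[ i < m ] (1 ℕ.+ q⁻ ℕ.* ind (inSpan? xs (y i)))
        ≡⟨ cong (⊥-count xs ℕ.*_) (trans (∑-distrib-+ {m} _ _)
             (cong₂ ℕ._+_ (trans (sum-const m 1) (ℕ.*-identityʳ m)) (sym (*-distribˡ-sum {m} q⁻ _)))) ⟩
      ⊥-count xs ℕ.* (m ℕ.+ q⁻ ℕ.* spanCount xs) ∎
      where
      open ≡-Reasoning
      φ : Fin m → Vec Carrier n → ℕ
      φ i h = ind (h ⊥? xs) ℕ.* ind (h ∙ y i ≟ 0#)

    -- The extremal case: incidence at least the average off the annihilator of K

    module Balanced (y≢0 : ∀ i → y i ≢ 0ⱽ) (K : Vec (Vec Carrier n) k)
      (c : ℕ) (m≡qc : m ≡ q ℕ.* c)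
      (c≤incidence : ∀ h → ¬ h ⊥ K → c ≤ incidence h) where

      private
        in⊥ out⊥ : Vec Carrier n → ℕ
        in⊥ h  = ind (h ⊥? K)
        out⊥ h = ind (¬? (h ⊥? K))

        split : (φ : Vec Carrier n → ℕ) →
          ∑ⱽ φ ≡ ∑ⱽ (λ h → in⊥ h ℕ.* φ h) ℕ.+ ∑ⱽ (λ h → out⊥ h ℕ.* φ h)
        split φ = trans
          (sumOver-cong (vectors↔Fin n) λ h → trans (sym (ℕ.*-identityˡ (φ h)))
            (trans (cong (ℕ._* φ h) (sym (ind-complement (h ⊥? K))))
                   (ℕ.*-distribʳ-+ (φ h) (in⊥ h) (out⊥ h))))
          (∑-distrib-+ {q ^ n} _ _)

        out≤ : ∀ h → out⊥ h ℕ.* c ≤ out⊥ h ℕ.* incidence h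
        out≤ h with h ⊥? K
        ... | yes _   = z≤n
        ... | no ¬h⊥K = ℕ.+-monoˡ-≤ 0 (c≤incidence h ¬h⊥K)

        -- Cancelling N q c leaves N (q - 1) s + q X = q Y, and `Y ≤ X` leaves no room for the first
        -- term. In the application N counts the functionals in K⊥, s the vectors in the span of
        -- `K`, X is the total incidence off K⊥ and Y its lower bound.
        numeric : ∀ {N s X Y} .{{_ : NonZero N}} →
          N ℕ.* (q ℕ.* c ℕ.+ q⁻ ℕ.* s) ℕ.+ q ℕ.* X ≡ N ℕ.* (q ℕ.* c) ℕ.+ q ℕ.* Y →
          Y ≤ X → s ≡ 0 × X ≤ Y
        numeric {N} {s} {X} {Y} eq Y≤X = s≡0 , X≤Y
          where
          qY≡ : N ℕ.* (q⁻ ℕ.* s) ℕ.+ q ℕ.* X ≡ q ℕ.* Y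
          qY≡ = ℕ.+-cancelˡ-≡ (N ℕ.* (q ℕ.* c)) _ _
            (trans (sym (ℕ.+-assoc (N ℕ.* (q ℕ.* c)) _ _))
            (trans (cong (ℕ._+ q ℕ.* X) (sym (ℕ.*-distribˡ-+ N (q ℕ.* c) (q⁻ ℕ.* s)))) eq))

          X≤Y : X ≤ Y
          X≤Y = ℕ.*-cancelˡ-≤ q (subst (q ℕ.* X ≤_) qY≡ (ℕ.m≤n+m _ _))

          Nq⁻s≡0 : N ℕ.* (q⁻ ℕ.* s) ≡ 0
          Nq⁻s≡0 = ℕ.+-cancelʳ-≡ (q ℕ.* X) _ 0
            (trans qY≡ (cong (q ℕ.*_) (ℕ.≤-antisym Y≤X X≤Y)))

          s≡0 : s ≡ 0
          s≡0 = ℕ.m*n≡0⇒m≡0 s q⁻ (trans (ℕ.*-comm s q⁻)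
            (ℕ.m*n≡0⇒m≡0 _ N (trans (ℕ.*-comm _ N) Nq⁻s≡0)))

        ⊥-count-[] : ⊥-count {n} [] ≡ ⊥-count K ℕ.+ ∑ⱽ out⊥
        ⊥-count-[] = trans (split (λ _ → 1)) (cong₂ ℕ._+_
          (sumOver-cong (vectors↔Fin n) (ℕ.*-identityʳ ∘ in⊥))
          (sumOver-cong (vectors↔Fin n) (ℕ.*-identityʳ ∘ out⊥)))

        spanCount-[] : spanCount [] ≡ 0
        spanCount-[] = sum-zero λ i → ind-no (inSpan? [] (y i)) (λ { ([] , eq) → y≢0 i (sym eq) })

        X Y : ℕ
        X = ∑ⱽ λ h → out⊥ h ℕ.* incidence h
        Y = ∑ⱽ λ h → out⊥ h ℕ.* c

        -- Both sides are q times the total incidence. On the left it is split along K⊥ and the part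
        -- inside is counted with `∑-incidence K`; on the right it is counted with `∑-incidence []`,
        -- and only the number of functionals is split.
        balance : ⊥-count K ℕ.* (q ℕ.* c ℕ.+ q⁻ ℕ.* spanCount K) ℕ.+ q ℕ.* X ≡
                  ⊥-count K ℕ.* (q ℕ.* c) ℕ.+ q ℕ.* Y
        balance = begin
          ⊥-count K ℕ.* (q ℕ.* c ℕ.+ q⁻ ℕ.* spanCount K) ℕ.+ q ℕ.* X
            ≡⟨ cong (λ z → ⊥-count K ℕ.* (z ℕ.+ q⁻ ℕ.* spanCount K) ℕ.+ q ℕ.* X) m≡qc ⟨
          ⊥-count K ℕ.* (m ℕ.+ q⁻ ℕ.* spanCount K) ℕ.+ q ℕ.* X
            ≡⟨ cong (ℕ._+ q ℕ.* X) (∑-incidence K) ⟨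
          q ℕ.* ∑ⱽ (λ h → in⊥ h ℕ.* incidence h) ℕ.+ q ℕ.* X
            ≡⟨ ℕ.*-distribˡ-+ q _ X ⟨
          q ℕ.* (∑ⱽ (λ h → in⊥ h ℕ.* incidence h) ℕ.+ X)
            ≡⟨ cong (q ℕ.*_) (split incidence) ⟨
          q ℕ.* ∑ⱽ incidence
            ≡⟨ cong (q ℕ.*_) (sumOver-cong (vectors↔Fin n) (sym ∘ ℕ.*-identityˡ ∘ incidence)) ⟩
          q ℕ.* ∑ⱽ (λ h → ind (h ⊥? []) ℕ.* incidence h)
            ≡⟨ ∑-incidence [] ⟩
          ⊥-count {n} [] ℕ.* (m ℕ.+ q⁻ ℕ.* spanCount [])
            ≡⟨ cong (⊥-count {n} [] ℕ.*_) (cong₂ ℕ._+_ m≡qc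
                 (trans (cong (q⁻ ℕ.*_) spanCount-[]) (ℕ.*-zeroʳ q⁻))) ⟩
          ⊥-count {n} [] ℕ.* (q ℕ.* c ℕ.+ 0)
            ≡⟨ cong₂ ℕ._*_ ⊥-count-[] (ℕ.+-identityʳ _) ⟩
          (⊥-count K ℕ.+ ∑ⱽ out⊥) ℕ.* (q ℕ.* c)
            ≡⟨ rearrange (⊥-count K) (∑ⱽ out⊥) q c ⟩
          ⊥-count K ℕ.* (q ℕ.* c) ℕ.+ q ℕ.* (∑ⱽ out⊥ ℕ.* c)
            ≡⟨ cong (λ z → ⊥-count K ℕ.* (q ℕ.* c) ℕ.+ q ℕ.* z) (*-distribʳ-sum {q ^ n} c _) ⟩
          ⊥-count K ℕ.* (q ℕ.* c) ℕ.+ q ℕ.* Y ∎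
          where
          open ≡-Reasoning
          rearrange : ∀ N M q c → (N ℕ.+ M) ℕ.* (q ℕ.* c) ≡ N ℕ.* (q ℕ.* c) ℕ.+ q ℕ.* (M ℕ.* c)
          rearrange = solve-∀ℕ

        equality : spanCount K ≡ 0 × X ≤ Y
        equality = numeric {{⊥-count-nonZero K}} balance (sum-mono-≤ (out≤ ∘ Inverse.from (vectors↔Fin n)))

      ∉-span : ∀ i → ¬ InSpan K (y i)
      ∉-span i yi∈K = ℕ.n≮0 (ℕ.≤-trans
        (ℕ.≤-reflexive (sym (ind-yes (inSpan? K (y i)) yi∈K)))
        (ℕ.≤-trans (term≤sum (λ i → ind (inSpan? K (y i))) i) (ℕ.≤-reflexive (proj₁ equality))))

      incidence≡c : ∀ h → ¬ h ⊥ K → incidence h ≡ c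
      incidence≡c h ¬h⊥K = begin
        incidence h                  ≡⟨ ℕ.*-identityˡ _ ⟨
        1 ℕ.* incidence h            ≡⟨ cong (ℕ._* incidence h) (ind-yes (¬? (h ⊥? K)) ¬h⊥K) ⟨
        out⊥ h ℕ.* incidence h       ≡⟨ tight ⟨
        out⊥ h ℕ.* c                 ≡⟨ cong (ℕ._* c) (ind-yes (¬? (h ⊥? K)) ¬h⊥K) ⟩
        1 ℕ.* c                      ≡⟨ ℕ.*-identityˡ c ⟩
        c                            ∎
        where
        open ≡-Reasoning
        open Inverse (vectors↔Fin n)
        tight : out⊥ h ℕ.* c ≡ out⊥ h ℕ.* incidence h
        tight = subst (λ h → out⊥ h ℕ.* c ≡ out⊥ h ℕ.* incidence h) (strictlyInverseʳ h)
          (sum-mono-≤-tight (out≤ ∘ from) (proj₂ equality) (to h))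

      private
        -- Written with a one-element list, so that its sum is `⊥-count (x ∷ [])` by definition and
        -- `∑-incidence` applies directly.
        vanish : Vec Carrier n → Vec Carrier n → ℕ
        vanish x h = ind (h ⊥? (x ∷ []))

        -- The point is that the right-hand side does not depend on `x`: all nonzero vectors are
        -- killed by equally many functionals.
        q*⊥-count : ∀ {x} → x ≢ 0ⱽ → q ℕ.* ⊥-count (x ∷ []) ≡ ⊥-count {n} []
        q*⊥-count {x} x≢0 = begin
          q ℕ.* ⊥-count (x ∷ [])
            ≡⟨ cong (q ℕ.*_) (sumOver-cong (vectors↔Fin n) λ h → trans
                 (ind-cong (h ⊥? (x ∷ [])) (h ∙ x ≟ 0#) (λ { (p ∷ []) → p }) (_∷ []))
                 (sym (ℕ.*-identityˡ _))) ⟩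
          q ℕ.* ∑ⱽ (λ h → ind (h ⊥? []) ℕ.* ind (h ∙ x ≟ 0#))
            ≡⟨ ⊥-count-∧ [] x ⟩
          ⊥-count {n} [] ℕ.* (1 ℕ.+ q⁻ ℕ.* ind (inSpan? [] x))
            ≡⟨ cong (λ z → ⊥-count {n} [] ℕ.* (1 ℕ.+ q⁻ ℕ.* z))
                 (ind-no (inSpan? [] x) (λ { ([] , eq) → x≢0 (sym eq) })) ⟩
          ⊥-count {n} [] ℕ.* (1 ℕ.+ q⁻ ℕ.* 0)
            ≡⟨ cong (λ z → ⊥-count {n} [] ℕ.* suc z) (ℕ.*-zeroʳ q⁻) ⟩
          ⊥-count {n} [] ℕ.* 1
            ≡⟨ ℕ.*-identityʳ _ ⟩
          ⊥-count {n} [] ∎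
          where open ≡-Reasoning

        -- Since incidence - c is zero off K⊥, restricting it to K⊥ changes nothing. The identity
        -- says this for its product with `vanish x`, with the negative terms moved to the other
        -- side.
        pointwise : ∀ x h →
          vanish x h ℕ.* incidence h ℕ.+ in⊥ h ℕ.* (vanish x h ℕ.* c) ≡
          in⊥ h ℕ.* (vanish x h ℕ.* incidence h) ℕ.+ vanish x h ℕ.* c
        pointwise x h with h ⊥? K
        ... | yes _ = cong₂ ℕ._+_ (sym (ℕ.*-identityˡ (vanish x h ℕ.* incidence h))) (ℕ.*-identityˡ _)
        ... | no ¬h⊥K = trans (ℕ.+-identityʳ _) (cong (vanish x h ℕ.*_) (incidence≡c h ¬h⊥K))

        summed : ∀ x →
          ∑ⱽ (λ h → vanish x h ℕ.* incidence h) ℕ.+ ∑ⱽ (λ h → in⊥ h ℕ.* (vanish x h ℕ.* c)) ≡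
          ∑ⱽ (λ h → in⊥ h ℕ.* (vanish x h ℕ.* incidence h)) ℕ.+ ⊥-count (x ∷ []) ℕ.* c
        summed x = begin
          ∑ⱽ (λ h → vanish x h ℕ.* incidence h) ℕ.+ ∑ⱽ (λ h → in⊥ h ℕ.* (vanish x h ℕ.* c))
            ≡⟨ ∑-distrib-+ {q ^ n} _ _ ⟨
          ∑ⱽ (λ h → vanish x h ℕ.* incidence h ℕ.+ in⊥ h ℕ.* (vanish x h ℕ.* c))
            ≡⟨ sumOver-cong (vectors↔Fin n) (pointwise x) ⟩
          ∑ⱽ (λ h → in⊥ h ℕ.* (vanish x h ℕ.* incidence h) ℕ.+ vanish x h ℕ.* c)
            ≡⟨ ∑-distrib-+ {q ^ n} _ _ ⟩
          ∑ⱽ (λ h → in⊥ h ℕ.* (vanish x h ℕ.* incidence h)) ℕ.+ ∑ⱽ (λ h → vanish x h ℕ.* c)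
            ≡⟨ cong (∑ⱽ (λ h → in⊥ h ℕ.* (vanish x h ℕ.* incidence h)) ℕ.+_) (*-distribʳ-sum {q ^ n} c _) ⟨
          ∑ⱽ (λ h → in⊥ h ℕ.* (vanish x h ℕ.* incidence h)) ℕ.+ ⊥-count (x ∷ []) ℕ.* c ∎
          where open ≡-Reasoning

      -- By `summed`, the total incidence over the functionals killing `x` is determined by which
      -- functionals in K⊥ kill `x` and by how many kill `x` altogether. The first agrees for `x`
      -- and `z` by hypothesis, the second because both are nonzero, and `∑-incidence` recovers
      -- `spanCount` from that total.
      spanCount-invariant : ∀ {x z} → x ≢ 0ⱽ → z ≢ 0ⱽ →
        (∀ h → h ⊥ K → h ∙ x ≡ 0# → h ∙ z ≡ 0#) →
        (∀ h → h ⊥ K → h ∙ z ≡ 0# → h ∙ x ≡ 0#) →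
        spanCount (x ∷ []) ≡ spanCount (z ∷ [])
      spanCount-invariant {x} {z} x≢0 z≢0 x⇒z z⇒x =
        ℕ.*-cancelˡ-≡ _ _ q⁻ (ℕ.+-cancelˡ-≡ m _ _
          (ℕ.*-cancelˡ-≡ _ _ (⊥-count (x ∷ [])) {{⊥-count-nonZero (x ∷ [])}} (begin
            ⊥-count (x ∷ []) ℕ.* (m ℕ.+ q⁻ ℕ.* spanCount (x ∷ []))   ≡⟨ ∑-incidence (x ∷ []) ⟨
            q ℕ.* ∑ⱽ (λ h → vanish x h ℕ.* incidence h)              ≡⟨ cong (q ℕ.*_) W≡ ⟩
            q ℕ.* ∑ⱽ (λ h → vanish z h ℕ.* incidence h)              ≡⟨ ∑-incidence (z ∷ []) ⟩
            ⊥-count (z ∷ []) ℕ.* (m ℕ.+ q⁻ ℕ.* spanCount (z ∷ []))   ≡⟨ cong (ℕ._* _) N≡ ⟨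
            ⊥-count (x ∷ []) ℕ.* (m ℕ.+ q⁻ ℕ.* spanCount (z ∷ []))   ∎)))
        where
        open ≡-Reasoning
        N≡ : ⊥-count (x ∷ []) ≡ ⊥-count (z ∷ [])
        N≡ = ℕ.*-cancelˡ-≡ _ _ q (trans (q*⊥-count x≢0) (sym (q*⊥-count z≢0)))

        agree : (φ : Vec Carrier n → ℕ) →
          ∑ⱽ (λ h → in⊥ h ℕ.* (vanish x h ℕ.* φ h)) ≡ ∑ⱽ (λ h → in⊥ h ℕ.* (vanish z h ℕ.* φ h))
        agree φ = sumOver-cong (vectors↔Fin n) pt
          where
          pt : ∀ h → in⊥ h ℕ.* (vanish x h ℕ.* φ h) ≡ in⊥ h ℕ.* (vanish z h ℕ.* φ h)
          pt h with h ⊥? K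
          ... | no _    = refl
          ... | yes h⊥K = cong (λ w → 1 ℕ.* (w ℕ.* φ h))
            (ind-cong (h ⊥? (x ∷ [])) (h ⊥? (z ∷ []))
              (λ { (p ∷ []) → x⇒z h h⊥K p ∷ [] }) (λ { (p ∷ []) → z⇒x h h⊥K p ∷ [] }))

        W≡ : ∑ⱽ (λ h → vanish x h ℕ.* incidence h) ≡ ∑ⱽ (λ h → vanish z h ℕ.* incidence h)
        W≡ = ℕ.+-cancelʳ-≡ (∑ⱽ (λ h → in⊥ h ℕ.* (vanish x h ℕ.* c))) _ _ (begin
          _ ≡⟨ summed x ⟩
          _ ≡⟨ cong₂ ℕ._+_ (agree incidence) (cong (ℕ._* c) N≡) ⟩
          _ ≡⟨ summed z ⟨
          _ ≡⟨ cong (∑ⱽ (λ h → vanish z h ℕ.* incidence h) ℕ.+_) (agree (λ _ → c)) ⟨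
          _ ∎)

  -- Kernels of functionals

  record Linear (φ : Vec Carrier k → Vec Carrier n) : Set where
    field
      preserves-0           : φ 0ⱽ ≡ 0ⱽ
      preserves-combination : ∀ a x y → φ (a ·ⱽ x +ⱽ y) ≡ a ·ⱽ φ x +ⱽ φ y

  -- The images of the standard basis; `φ ∘ (0# ∷_)` is the restriction to vectors with first
  -- coordinate zero.
  images : (Vec Carrier k → Vec Carrier n) → Vec (Vec Carrier n) k
  images {zero}  φ = []
  images {suc k} φ = φ (1# ∷ 0ⱽ) ∷ images (φ ∘ (0# ∷_))

  linearCombination-images : {φ : Vec Carrier k → Vec Carrier n} → Linear φ →
    ∀ as → linearCombination as (images φ) ≡ φ as
  linearCombination-images φ-linear []       = sym (Linear.preserves-0 φ-linear)
  linearCombination-images {φ = φ} φ-linear (a ∷ as) = begin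
    a ·ⱽ φ (1# ∷ 0ⱽ) +ⱽ linearCombination as (images (φ ∘ (0# ∷_)))
      ≡⟨ cong (_ +ⱽ_) (linearCombination-images tail-linear as) ⟩
    a ·ⱽ φ (1# ∷ 0ⱽ) +ⱽ φ (0# ∷ as)
      ≡⟨ preserves-combination a _ _ ⟨
    φ (a * 1# + 0# ∷ a ·ⱽ 0ⱽ +ⱽ as)
      ≡⟨ cong φ (cong₂ _∷_ (trans (+-identityʳ _) (*-identityʳ a))
           (trans (cong (_+ⱽ as) (·ⱽ-zeroʳ a)) (+ⱽ-identityˡ as))) ⟩
    φ (a ∷ as) ∎
    where
    open ≡-Reasoning
    open Linear φ-linear
    tail-linear : Linear (φ ∘ (0# ∷_))
    tail-linear = record
      { preserves-0           = preserves-0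
      ; preserves-combination = λ a x y → trans
          (cong (λ c → φ (c ∷ a ·ⱽ x +ⱽ y)) (sym (trans (+-identityʳ _) (zeroʳ a))))
          (preserves-combination a _ _)
      }

  record KernelParametrization (h : Vec Carrier (suc n)) : Set where
    field
      φ          : Vec Carrier n → Vec Carrier (suc n)
      linear     : Linear φ
      injective  : ∀ x → φ x ≡ 0ⱽ → x ≡ 0ⱽ
      ∙-zero     : ∀ x → h ∙ φ x ≡ 0#
      surjective : ∀ y → h ∙ y ≡ 0# → ∃ λ x → φ x ≡ y

  -- The first nonzero entry of `h` is the pivot: the coordinate there is determined by the later
  -- ones, and all other coordinates are free.
  kernelParametrization : (h : Vec Carrier (suc n)) → h ≢ 0ⱽ → KernelParametrization h
  kernelParametrization {n} (a ∷ h) h≢0 with a ≟ 0#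
  ... | no a≢0 = record
    { φ          = λ x → b * h ∙ x ∷ x
    ; linear     = record
      { preserves-0           = cong (_∷ 0ⱽ) (trans (cong (b *_) (∙-zeroʳ h)) (zeroʳ b))
      ; preserves-combination = λ c x y → cong (_∷ c ·ⱽ x +ⱽ y)
          (trans (cong (b *_) (trans (∙-+ʳ h _ y) (cong (_+ h ∙ y) (∙-·ʳ h c x))))
                 (solve 4 (λ b c s t → b :* (c :* s :+ t) := c :* (b :* s) :+ b :* t)
                   refl b c (h ∙ x) (h ∙ y)))
      }
    ; injective  = λ x eq → cong Vec.tail eq
    ; ∙-zero     = λ x → trans
        (solve 3 (λ a b s → a :* (b :* s) :+ s := (a :* b :+ con 1) :* s) refl a b (h ∙ x))
        (trans (cong (_* h ∙ x) ab+1≡0) (zeroˡ _))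
    ; surjective = λ { (c ∷ y) eq → y , cong (_∷ y) (sym (begin
        c
          ≡⟨ +-identityʳ c ⟨
        c + 0#
          ≡⟨ cong (c +_) (trans (cong (b *_) eq) (zeroʳ b)) ⟨
        c + b * (a * c + h ∙ y)
          ≡⟨ solve 4 (λ a b c s → c :+ b :* (a :* c :+ s) := (a :* b :+ con 1) :* c :+ b :* s)
               refl a b c (h ∙ y) ⟩
        (a * b + 1#) * c + b * h ∙ y
          ≡⟨ cong (λ z → z * c + b * h ∙ y) ab+1≡0 ⟩
        0# * c + b * h ∙ y
          ≡⟨ trans (cong (_+ b * h ∙ y) (zeroˡ c)) (+-identityˡ _) ⟩
        b * h ∙ y ∎)) }
    }
    where
    open ≡-Reasoning
    -- Minus the inverse of `a`; the relation a b + 1 = 0 lets the semiring solver work without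
    -- negatives.
    b = - proj₁ (inverse a a≢0)
    ab+1≡0 : a * b + 1# ≡ 0#
    ab+1≡0 = trans (cong (_+ 1#) (trans (sym (-‿distribʳ-* a _)) (cong -_ (proj₂ (inverse a a≢0)))))
                   (-‿inverseˡ 1#)
  kernelParametrization {zero}  (a ∷ []) h≢0 | yes refl = contradiction refl h≢0
  kernelParametrization {suc n} (a ∷ h)  h≢0 | yes refl = record
    { φ          = λ { (c ∷ x) → c ∷ φ x }
    ; linear     = record
      { preserves-0           = cong (0# ∷_) preserves-0
      ; preserves-combination = λ { c (a ∷ x) (b ∷ y) → cong (_ ∷_) (preserves-combination c x y) }
      }
    ; injective  = λ { (c ∷ x) eq → cong₂ _∷_ (cong Vec.head eq) (injective x (cong Vec.tail eq)) }
    ; ∙-zero     = λ { (c ∷ x) → trans (cong₂ _+_ (zeroˡ c) (∙-zero x)) (+-identityˡ 0#) }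
    ; surjective = λ { (c ∷ y) eq →
        let x , φx≡y = surjective y (trans (sym (trans (cong (_+ h ∙ y) (zeroˡ c)) (+-identityˡ _))) eq)
        in c ∷ x , cong (c ∷_) φx≡y }
    }
    where
    open KernelParametrization (kernelParametrization h (h≢0 ∘ cong (0# ∷_)))
    open Linear linear

  x*y≡0⇒y≡0 : ∀ {a b} → a ≢ 0# → a * b ≡ 0# → b ≡ 0#
  x*y≡0⇒y≡0 {a} {b} a≢0 ab≡0 with c , ac≡1 ← inverse a a≢0 = begin
    b               ≡⟨ *-identityˡ b ⟨
    1# * b          ≡⟨ cong (_* b) ac≡1 ⟨
    a * c * b       ≡⟨ solve 3 (λ a b c → a :* c :* b := c :* (a :* b)) refl a b c ⟩
    c * (a * b)     ≡⟨ cong (c *_) ab≡0 ⟩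
    c * 0#          ≡⟨ zeroʳ c ⟩
    0#              ∎
    where open ≡-Reasoning

  -- A functional that kills `xs` and is 1 at `x` reads off the coefficient of `x` in a vanishing
  -- combination.
  independent-∷ : {x : Vec Carrier n} {xs : Vec (Vec Carrier n) k} →
    ¬ InSpan xs x → LinearlyIndependent xs → LinearlyIndependent (x ∷ xs)
  independent-∷ {x = x} {xs} x∉xs independent (a ∷ as) eq with separation xs x
  ... | inj₁ x∈xs = contradiction x∈xs x∉xs
  ... | inj₂ (w , w⊥xs , wx≡1) = cong₂ _∷_ (sym a≡0) (independent as (begin
    linearCombination as xs                ≡⟨ +ⱽ-identityˡ _ ⟨
    0ⱽ +ⱽ linearCombination as xs          ≡⟨ cong (_+ⱽ linearCombination as xs) (·ⱽ-zeroˡ x) ⟨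
    0# ·ⱽ x +ⱽ linearCombination as xs     ≡⟨ cong (λ c → c ·ⱽ x +ⱽ linearCombination as xs) a≡0 ⟩
    a ·ⱽ x +ⱽ linearCombination as xs      ≡⟨ eq ⟩
    0ⱽ                                     ∎))
    where
    open ≡-Reasoning
    a≡0 : 0# ≡ a
    a≡0 = begin
      0#                                                 ≡⟨ ∙-zeroʳ w ⟨
      w ∙ 0ⱽ                                             ≡⟨ cong (w ∙_) eq ⟨
      w ∙ (a ·ⱽ x +ⱽ linearCombination as xs)            ≡⟨ ∙-+ʳ w _ _ ⟩
      w ∙ (a ·ⱽ x) + w ∙ linearCombination as xs
        ≡⟨ cong₂ _+_ (∙-·ʳ w a x) (⊥-span {h = w} w⊥xs (as , refl)) ⟩
      a * w ∙ x + 0#                                     ≡⟨ +-identityʳ _ ⟩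
      a * w ∙ x                                          ≡⟨ cong (a *_) wx≡1 ⟩
      a * 1#                                             ≡⟨ *-identityʳ a ⟩
      a                                                  ∎

-- Projective geometry

module Geometry {q : ℕ} (F : FiniteField q) (v : ℕ) where
  open FiniteField F renaming (_≟_ to infix 4 _≟_)
  open ProjectiveSpace F v
  open Setoid pointSetoid using () renaming (refl to ≈-refl; sym to ≈-sym; trans to ≈-trans)
  open LinearAlgebra F
  open CommutativeRing commutativeRing
    using (+-identityˡ; +-identityʳ; *-comm; *-identityʳ; zeroʳ; *-assoc; -‿inverseʳ)
  open import Algebra.Properties.Ring (CommutativeRing.ring commutativeRing)
    using (-‿distribˡ-*)

  private
    variable
      k l : ℕ

  spanned : (xs : Vec Vector k) → LinearlyIndependent xs → Space k
  spanned xs independent = record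
    { subspace = record
      { Member   = InSpan xs
      ; 0-closed = replicate _ 0# , linearCombination-0 xs
      ; +-closed = λ { (as , refl) (bs , refl) → zipWith _+_ as bs , linearCombination-+ as bs xs }
      ; ·-closed = λ { c (as , refl) → map (c *_) as , linearCombination-· c as xs }
      }
    ; basis = record
      { vectors     = xs
      ; contained   = contained xs
      ; independent = independent
      ; spanning    = λ x∈xs → x∈xs
      }
    }
    where
    contained : ∀ {k} (xs : Vec Vector k) → All (InSpan xs) xs
    contained []       = []
    contained (x ∷ xs) =
      (1# ∷ replicate _ 0# , trans (cong₂ _+ⱽ_ (·ⱽ-identityˡ x) (linearCombination-0 xs)) (+ⱽ-identityʳ x)) ∷
      All.map (λ { (as , refl) → 0# ∷ as , trans (cong (_+ⱽ _) (·ⱽ-zeroˡ x)) (+ⱽ-identityˡ _) }) (contained xs)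

  -- The space is built through kernelParametrization because Divisible asks
  -- for hyperplanes that carry a basis.
  kernel : (h : Vector) → h ≢ 0ⱽ → ∃ λ k → suc k ≡ v ×
           ∃ λ (H : Space k) → ∀ x → (Space.Member H x → h ∙ x ≡ 0#) × (h ∙ x ≡ 0# → Space.Member H x)
  kernel = kernel′ v
    where
    kernel′ : ∀ v (h : Vec Carrier v) → h ≢ replicate v 0# → ∃ λ k → suc k ≡ v ×
      Σ-syntax (ProjectiveSpace.Space F v k) λ H → ∀ x →
        (ProjectiveSpace.Space.Member H x → h ∙ x ≡ 0#) ×
        (h ∙ x ≡ 0# → ProjectiveSpace.Space.Member H x)
    kernel′ zero    [] h≢0 = contradiction refl h≢0
    kernel′ (suc k) h  h≢0 = k , refl , space , λ x → (λ p → p) , (λ p → p)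
      where
      open KernelParametrization (kernelParametrization h h≢0)
      contained : ∀ {m} (ψ : Vec Carrier m → Vec Carrier (suc k)) →
                  (∀ x → h ∙ ψ x ≡ 0#) → h ⊥ images ψ
      contained {zero}  ψ ∙ψ≡0 = []
      contained {suc m} ψ ∙ψ≡0 = ∙ψ≡0 _ ∷ contained (ψ ∘ (0# ∷_)) (∙ψ≡0 ∘ (0# ∷_))

      space : ProjectiveSpace.Space F (suc k) k
      space = record
        { subspace = record
          { Member   = λ x → h ∙ x ≡ 0#
          ; 0-closed = ∙-zeroʳ h
          ; +-closed = λ {x} {y} hx hy → trans (∙-+ʳ h x y) (trans (cong₂ _+_ hx hy) (+-identityˡ 0#))
          ; ·-closed = λ a {x} hx → trans (∙-·ʳ h a x) (trans (cong (a *_) hx) (zeroʳ a))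
          }
        ; basis = record
          { vectors     = images φ
          ; contained   = contained φ ∙-zero
          ; independent = λ as eq → injective as (trans (sym (linearCombination-images linear as)) eq)
          ; spanning    = λ {y} hy≡0 → let x , φx≡y = surjective y hy≡0
                                       in x , trans (linearCombination-images linear x) φx≡y
          }
        }

  inSpan⇒member : (U : Space k) → ∀ {x} → InSpan (Space.vectors U) x → x ∈ Space.Member U
  inSpan⇒member U (as , eq) =
    subst (Space.Member U) eq (linearCombination-closed U as (Space.contained U))

  ⊥-member : {h : Vector} (U : Space k) → h ⊥ Space.vectors U →
             ∀ {x} → x ∈ Space.Member U → h ∙ x ≡ 0#
  ⊥-member {h = h} U h⊥U x∈U = ⊥-span {h = h} h⊥U (Space.spanning U x∈U)

  separation-space : (U : Space k) (x : Vector) → x ∈ Space.Member U ⊎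
    ∃ λ w → (∀ {y} → y ∈ Space.Member U → w ∙ y ≡ 0#) × w ∙ x ≡ 1#
  separation-space U x with separation (Space.vectors U) x
  ... | inj₁ x∈U             = inj₁ (inSpan⇒member U x∈U)
  ... | inj₂ (w , w⊥U , wx≡1) = inj₂ (w , ⊥-member {h = w} U w⊥U , wx≡1)

  -- Points and their generators

  generator : Point → Vector
  generator P = Vec.head (Space.vectors P)

  generator-member : (P : Point) → generator P ∈ Space.Member P
  generator-member P = All-head (Space.contained P)
    where
    All-head : ∀ {xs : Vec Vector 1} → All (Space.Member P) xs → Vec.head xs ∈ Space.Member P
    All-head (p ∷ []) = p

  private
    linearCombination-singleton : (as : Vec Carrier 1) (xs : Vec Vector 1) →
      linearCombination as xs ≡ Vec.head as ·ⱽ Vec.head xs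
    linearCombination-singleton (a ∷ []) (x ∷ []) = +ⱽ-identityʳ _

  generator≢0 : (P : Point) → generator P ≢ 0ⱽ
  generator≢0 P eq = 0#≢1# (sym (cong Vec.head (Space.independent P (1# ∷ [])
    (trans (linearCombination-singleton (1# ∷ []) (Space.vectors P))
           (trans (cong (1# ·ⱽ_) eq) (·ⱽ-zeroʳ 1#))))))

  generates : (P : Point) → ∀ {x} → x ∈ Space.Member P → ∃ λ a → a ·ⱽ generator P ≡ x
  generates P x∈P with as , refl ← Space.spanning P x∈P =
    Vec.head as , sym (linearCombination-singleton as (Space.vectors P))

  ⊑-intro : (P : Point) (U : Space k) → generator P ∈ Space.Member U → P ⊑ U
  ⊑-intro P U p∈U x∈P with a , refl ← generates P x∈P = Space.·-closed U a p∈U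

  ⊑⇒≈ : (P Q : Point) → P ⊑ Q → P ≈ Q
  ⊑⇒≈ P Q P⊑Q = P⊑Q , ⊑-intro Q P q∈P
    where
    q∈P : generator Q ∈ Space.Member P
    q∈P with a , aq≡p ← generates Q (P⊑Q (generator-member P)) with a ≟ 0#
    ... | yes refl = contradiction (trans (sym aq≡p) (·ⱽ-zeroˡ _)) (generator≢0 P)
    ... | no a≢0 with b , ab≡1 ← inverse a a≢0 = subst (Space.Member P)
      (trans (cong (b ·ⱽ_) (sym aq≡p)) (trans (·ⱽ-assoc b a _)
        (trans (cong (_·ⱽ generator Q) (trans (*-comm b a) ab≡1)) (·ⱽ-identityˡ _))))
      (Space.·-closed P b (generator-member P))

  point : (x : Vector) → x ≢ 0ⱽ → Point
  point x x≢0 = spanned (x ∷ []) (independent-∷ (λ { ([] , eq) → x≢0 (sym eq) }) (λ { [] _ → refl }))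

  inSpan-generator : (P : Point) → ∀ {x} → x ∈ Space.Member P → InSpan (generator P ∷ []) x
  inSpan-generator P x∈P with a , refl ← generates P x∈P = a ∷ [] , +ⱽ-identityʳ _

  generators : (S : Multiset) → Fin (length S) → Vector
  generators S i = generator (List.lookup S i)

  -- Gives access to multiplicities through functionals: a generator of Q is a multiple of the
  -- generator of P exactly when the two points coincide.
  multiplicity-spanCount : (S : Multiset) (P : Point) →
    multiplicity S P ≡ spanCount (generators S) (generator P ∷ [])
  multiplicity-spanCount S P = trans (length-filter-lookup (P ≈?_) S)
    (sum-cong-≗ λ i → let Q = List.lookup S i in
      ind-cong (P ≈? Q) (inSpan? (generator P ∷ []) (generator Q))
        (λ (_ , Q⊑P) → inSpan-generator P (Q⊑P (generator-member Q)))
        (λ { (a ∷ [] , eq) → ≈-sym {Q} {P} (⊑⇒≈ Q P (⊑-intro Q P (subst (Space.Member P)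
          (trans (sym (+ⱽ-identityʳ _)) eq) (Space.·-closed P a (generator-member P))))) }))

  incidence-kernel : (S : Multiset) (h : Vector) (H : Space k) →
    (∀ x → (Space.Member H x → h ∙ x ≡ 0#) × (h ∙ x ≡ 0# → Space.Member H x)) →
    ∣ S ∩ H ∣ ≡ incidence (generators S) h
  incidence-kernel S h H H≡ker = trans (length-filter-lookup (_⊑? H) S)
    (sum-cong-≗ λ i → let P = List.lookup S i in
      ind-cong (P ⊑? H) (h ∙ generator P ≟ 0#)
        (λ P⊑H → proj₁ (H≡ker _) (P⊑H (generator-member P)))
        (λ hp≡0 → ⊑-intro P H (proj₂ (H≡ker _) hp≡0)))

  -- Counting takes the place of an exchange argument: coordinates with respect to `W` inject q^k
  -- coefficient vectors into q^l.
  ⊑⇒≤-dimension : (U : Space k) (W : Space l) → U ⊑ W → k ≤ l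
  ⊑⇒≤-dimension {k} {l} U W U⊑W = ℕ.≮⇒≥ λ l<k → ℕ.<⇒≱ (ℕ.^-monoʳ-< q 2≤q l<k)
    (injective⇒≤ {f = λ i → to (vectors↔Fin l) (coordinates (from (vectors↔Fin k) i))} λ eq →
      from-injective (vectors↔Fin k) (coordinates-injective (to-injective (vectors↔Fin l) eq)))
    where
    open Inverse using (to; from; strictlyInverseˡ; strictlyInverseʳ)
    to-injective : ∀ {A : Set} {n} (e : A ↔ Fin n) {x y} → to e x ≡ to e y → x ≡ y
    to-injective e eq = trans (sym (strictlyInverseʳ e _)) (trans (cong (from e) eq) (strictlyInverseʳ e _))
    from-injective : ∀ {A : Set} {n} (e : A ↔ Fin n) {x y} → from e x ≡ from e y → x ≡ y
    from-injective e eq = trans (sym (strictlyInverseˡ e _)) (trans (cong (to e) eq) (strictlyInverseˡ e _))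
    expand : (as : Vec Carrier k) → InSpan (Space.vectors W) (linearCombination as (Space.vectors U))
    expand as = Space.spanning W (U⊑W (inSpan⇒member U (as , refl)))
    coordinates : Vec Carrier k → Vec Carrier l
    coordinates = proj₁ ∘ expand
    coordinates-injective : ∀ {as bs} → coordinates as ≡ coordinates bs → as ≡ bs
    coordinates-injective {as} {bs} eq =
      linearCombination-injective (Space.vectors U) (Space.independent U) as bs
        (trans (sym (proj₂ (expand as)))
          (trans (cong (λ cs → linearCombination cs (Space.vectors W)) eq) (proj₂ (expand bs))))

  -- The spaces ⟨x , K⟩ and their points outside K

  module Join {r : ℕ} (K : Space r) where

    join : (x : Vector) → ¬ x ∈ Space.Member K → Space (suc r)
    join x x∉K = spanned (x ∷ Space.vectors K)
      (independent-∷ (x∉K ∘ inSpan⇒member K) (Space.independent K))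

    ⊑-join : ∀ x x∉K → K ⊑ join x x∉K
    ⊑-join x x∉K y∈K with as , refl ← Space.spanning K y∈K =
      0# ∷ as , trans (cong (_+ⱽ _) (·ⱽ-zeroˡ x)) (+ⱽ-identityˡ _)

    ∈-join : ∀ x x∉K → x ∈ Space.Member (join x x∉K)
    ∈-join x x∉K = All.head (Space.contained (join x x∉K))

    join-least : ∀ x x∉K (U : Space k) → x ∈ Space.Member U → K ⊑ U → join x x∉K ⊑ U
    join-least x x∉K U x∈U K⊑U (a ∷ as , refl) =
      Space.+-closed U (Space.·-closed U a x∈U) (K⊑U (inSpan⇒member K (as , refl)))

    ∙-join : ∀ {h x x∉K y} → (∀ {z} → z ∈ Space.Member K → h ∙ z ≡ 0#) →
             y ∈ Space.Member (join x x∉K) → h ∙ x ≡ 0# → h ∙ y ≡ 0#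
    ∙-join {h} {x} {x∉K} h⊥K y∈J hx≡0 =
      ⊥-member {h = h} (join x x∉K) (hx≡0 ∷ All.map h⊥K (Space.contained K)) y∈J

    -- Modulo `K` the vector `y` is a nonzero multiple of `x`, because it lies outside `K`.
    ∙-join⁻ : ∀ {h x x∉K y} → (∀ {z} → z ∈ Space.Member K → h ∙ z ≡ 0#) →
              y ∈ Space.Member (join x x∉K) → ¬ y ∈ Space.Member K → h ∙ y ≡ 0# → h ∙ x ≡ 0#
    ∙-join⁻ {h} {x} h⊥K (a ∷ as , refl) y∉K hy≡0 = x*y≡0⇒y≡0 a≢0 (begin
      a * h ∙ x                                        ≡⟨ +-identityʳ _ ⟨
      a * h ∙ x + 0#
        ≡⟨ cong₂ _+_ (∙-·ʳ h a x) (h⊥K (inSpan⇒member K (as , refl))) ⟨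
      h ∙ (a ·ⱽ x) + h ∙ linearCombination as _        ≡⟨ ∙-+ʳ h _ _ ⟨
      h ∙ (a ·ⱽ x +ⱽ linearCombination as _)           ≡⟨ hy≡0 ⟩
      0#                                               ∎)
      where
      open ≡-Reasoning
      a≢0 : a ≢ 0#
      a≢0 refl = y∉K (inSpan⇒member K (as , sym (trans (cong (_+ⱽ _) (·ⱽ-zeroˡ x)) (+ⱽ-identityˡ _))))

    -- If `x` were outside `U`, a functional killing `U` but not `x` would kill `K` and `y`,
    -- contradicting `∙-join⁻`. Hence two joins that share a vector outside `K` coincide.
    join-⊑ : ∀ {x x∉K y} (U : Space k) → y ∈ Space.Member (join x x∉K) → ¬ y ∈ Space.Member K →
             y ∈ Space.Member U → K ⊑ U → join x x∉K ⊑ U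
    join-⊑ {x = x} {x∉K} U y∈J y∉K y∈U K⊑U with separation-space U x
    ... | inj₁ x∈U              = join-least x x∉K U x∈U K⊑U
    ... | inj₂ (w , w⊥U , wx≡1) = contradiction
      (trans (sym (∙-join⁻ {w} {x} {x∉K} (w⊥U ∘ K⊑U) y∈J y∉K (w⊥U y∈U))) wx≡1) 0#≢1#

    -- Normalising representatives by w ∙ y = 1, where w vanishes on K and
    -- w ∙ x = 1, identifies the points of join x ∖ K with x + K, and K with
    -- the r-tuples of coefficients.
    module AffinePoints (x : Vector) (x∉K : ¬ x ∈ Space.Member K) (w : Vector)
      (w⊥K : ∀ {y} → y ∈ Space.Member K → w ∙ y ≡ 0#) (wx≡1 : w ∙ x ≡ 1#) where

      private
        J : Space (suc r)
        J = join x x∉K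

        κ : Vec Carrier r → Vector
        κ as = linearCombination as (Space.vectors K)

        κ∈K : ∀ as → κ as ∈ Space.Member K
        κ∈K as = inSpan⇒member K (as , refl)

      w∙affine : ∀ as → w ∙ (x +ⱽ κ as) ≡ 1#
      w∙affine as = trans (∙-+ʳ w x _) (trans (cong₂ _+_ wx≡1 (w⊥K (κ∈K as))) (+-identityʳ 1#))

      affine : Vec Carrier r → Point
      affine as = point (x +ⱽ κ as) λ eq →
        0#≢1# (trans (sym (∙-zeroʳ w)) (trans (cong (w ∙_) (sym eq)) (w∙affine as)))

      affine-∈ : ∀ as → affine as ∈ J ∖ K
      affine-∈ as =
        ⊑-intro (affine as) J (1# ∷ as , cong (_+ⱽ κ as) (·ⱽ-identityˡ x)) ,
        λ A⊑K → 0#≢1# (trans (sym (w⊥K (A⊑K (generator-member (affine as))))) (w∙affine as))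

      affine-injective : ∀ as bs → affine as ⊑ affine bs → as ≡ bs
      affine-injective as bs A⊑B with c , eq ← generates (affine bs) (A⊑B (generator-member (affine as))) =
        linearCombination-injective (Space.vectors K) (Space.independent K) as bs
          (+ⱽ-cancelˡ x _ _ (trans (sym eq) (trans (cong (_·ⱽ (x +ⱽ κ bs)) c≡1) (·ⱽ-identityˡ _))))
        where
        open ≡-Reasoning
        c≡1 : c ≡ 1#
        c≡1 = begin
          c                             ≡⟨ *-identityʳ c ⟨
          c * 1#                        ≡⟨ cong (c *_) (w∙affine bs) ⟨
          c * w ∙ (x +ⱽ κ bs)           ≡⟨ ∙-·ʳ w c _ ⟨
          w ∙ (c ·ⱽ (x +ⱽ κ bs))        ≡⟨ cong (w ∙_) eq ⟩
          w ∙ (x +ⱽ κ as)               ≡⟨ w∙affine as ⟩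
          1#                            ∎

      affine-surjective : ∀ P → P ∈ J ∖ K → ∃ λ as → affine as ≈ P
      affine-surjective P (P⊑J , P⋢K) with P⊑J (generator-member P)
      ... | a ∷ as , eq with a ≟ 0#
      ...   | yes refl = ⊥-elim (P⋢K (⊑-intro P K
        (inSpan⇒member K (as , trans (sym (trans (cong (_+ⱽ _) (·ⱽ-zeroˡ x)) (+ⱽ-identityˡ _))) eq))))
      ...   | no a≢0 with b , ab≡1 ← inverse a a≢0 = map (b *_) as ,
        ⊑⇒≈ (affine (map (b *_) as)) P (⊑-intro (affine (map (b *_) as)) P (subst (Space.Member P) scaled
          (Space.·-closed P b (generator-member P))))
        where
        open ≡-Reasoning
        scaled : b ·ⱽ generator P ≡ x +ⱽ κ (map (b *_) as)
        scaled = begin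
          b ·ⱽ generator P                     ≡⟨ cong (b ·ⱽ_) eq ⟨
          b ·ⱽ (a ·ⱽ x +ⱽ κ as)                ≡⟨ ·ⱽ-distrib-combination b a x _ ⟩
          (b * a) ·ⱽ x +ⱽ b ·ⱽ κ as            ≡⟨ cong₂ _+ⱽ_ (trans (cong (_·ⱽ x) (trans (*-comm b a) ab≡1)) (·ⱽ-identityˡ x))
                                                     (sym (linearCombination-· b as (Space.vectors K))) ⟩
          x +ⱽ κ (map (b *_) as)               ∎

      -- Writes membership in J as a sum of equality tests, so that after exchanging sums the number
      -- of points of a multiset in J becomes a sum of q^r multiplicities.
      ind-∑-affine : ∀ P → ¬ P ⊑ K → (P⊑?J : Dec (P ⊑ J)) →
        ind P⊑?J ≡ sumOver (vectors↔Fin r) (λ as → ind (affine as ≈? P))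
      ind-∑-affine P P⋢K (yes P⊑J) = let as , A⊑P , P⊑A = affine-surjective P (P⊑J , P⋢K) in
        sym (sumOver-ind-unique (vectors↔Fin r) (λ as → affine as ≈? P) as (A⊑P , P⊑A)
          λ bs (B⊑P , _) → affine-injective bs as λ p → P⊑A (B⊑P p))
      ind-∑-affine P P⋢K (no P⋢J) = sym (sum-zero λ i → let as = Inverse.from (vectors↔Fin r) i in
        ind-no (affine as ≈? P) λ (_ , P⊑A) → P⋢J λ p → proj₁ (affine-∈ as) (P⊑A p))

      length-filter-join : (T : Multiset) → ListAll.All (λ P → ¬ P ⊑ K) T →
        (∀ R → R ∈ J ∖ K → multiplicity T R ≡ 1) →
        length (filter (_⊑? J) T) ≡ q ^ r
      length-filter-join T T∩K≡∅ simple = begin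
        length (filter (_⊑? J) T)
          ≡⟨ length-filter-lookup (_⊑? J) T ⟩
        ∑[ i < length T ] ind (List.lookup T i ⊑? J)
          ≡⟨ sum-cong-≗ (λ i → ind-∑-affine (List.lookup T i)
               (ListAll.lookup T∩K≡∅ (∈-lookup i)) (List.lookup T i ⊑? J)) ⟩
        ∑[ i < length T ] sumOver (vectors↔Fin r) (λ as → ind (affine as ≈? List.lookup T i))
          ≡⟨ ∑-comm {length T} {q ^ r} _ ⟩
        sumOver (vectors↔Fin r) (λ as → ∑[ i < length T ] ind (affine as ≈? List.lookup T i))
          ≡⟨ sumOver-cong (vectors↔Fin r) (λ as → trans
               (sym (length-filter-lookup (affine as ≈?_) T)) (simple (affine as) (affine-∈ as))) ⟩
        sumOver (vectors↔Fin r) (λ _ → 1)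
          ≡⟨ trans (sum-const (q ^ r) 1) (ℕ.*-identityʳ _) ⟩
        q ^ r ∎
        where open ≡-Reasoning

    length-filter-join : ∀ x x∉K (T : Multiset) → ListAll.All (λ P → ¬ P ⊑ K) T →
      (∀ R → R ∈ join x x∉K ∖ K → multiplicity T R ≡ 1) →
      length (filter (_⊑? join x x∉K) T) ≡ q ^ r
    length-filter-join x x∉K with separation-space K x
    ... | inj₁ x∈K              = contradiction x∈K x∉K
    ... | inj₂ (w , w⊥K , wx≡1) = AffinePoints.length-filter-join x x∉K w w⊥K wx≡1

    -- Induction on n: the join J of the first point with `K` contains exactly q^r entries, and
    -- these are removed. The last hypothesis speaks only of joins that contain a point of `T`; in
    -- this form it survives the removal, because distinct joins are disjoint outside `K`.
    partition : ∀ n (T : Multiset) → length T ≡ n ℕ.* q ^ r →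
      ListAll.All (λ P → ¬ P ⊑ K) T →
      (∀ x x∉K → Any (_⊑ join x x∉K) T → ∀ R → R ∈ join x x∉K ∖ K → multiplicity T R ≡ 1) →
      Σ-syntax (Fin n → Space (suc r)) λ L → (∀ i → K ⊑ L i) ×
        (∀ P → multiplicity T P ≡ ∑[ i < n ] ind (P ∈? L i ∖ K))
    partition zero    []      _      _ _ = (λ ()) , (λ ()) , λ _ → refl
    partition (suc n) []      length≡ = contradiction (sym length≡)
      (ℕ.≢-nonZero⁻¹ _ {{ℕ.>-nonZero (ℕ.≤-trans (ℕ.m^n>0 q r) (ℕ.m≤m+n _ _))}})
    partition (suc n) T@(P ∷ _) length≡ T∩K≡∅@(P⋢K ∷ _) simple =
      L , K⊑L , count
      where
      p∉K : ¬ generator P ∈ Space.Member K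
      p∉K p∈K = P⋢K (⊑-intro P K p∈K)

      J : Space (suc r)
      J = join (generator P) p∉K

      K⊑J : K ⊑ J
      K⊑J = ⊑-join (generator P) p∉K

      simpleJ : ∀ R → R ∈ J ∖ K → multiplicity T R ≡ 1
      simpleJ = simple (generator P) p∉K (here (⊑-intro P J (∈-join (generator P) p∉K)))

      ⋢J? : Decidable (λ Q → ¬ Q ⊑ J)
      ⋢J? Q = ¬? (Q ⊑? J)

      T′ : Multiset
      T′ = filter ⋢J? T

      length′ : length T′ ≡ n ℕ.* q ^ r
      length′ = ℕ.+-cancelˡ-≡ (q ^ r) _ _ (trans
        (cong (ℕ._+ length T′) (sym (length-filter-join (generator P) p∉K T T∩K≡∅ simpleJ)))
        (trans (sym (length-filter-complement (_⊑? J) T)) length≡))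

      multiplicity-outside : ∀ {R} → ¬ R ⊑ J → multiplicity T′ R ≡ multiplicity T R
      multiplicity-outside {R} R⋢J = length-filter-filter-⊆ (R ≈?_) ⋢J?
        (λ (R⊑Q , _) Q⊑J → R⋢J λ p → Q⊑J (R⊑Q p)) T

      multiplicity-inside : ∀ {R} → R ⊑ J → multiplicity T′ R ≡ 0
      multiplicity-inside {R} R⊑J = length-filter-filter-disjoint (R ≈?_) ⋢J?
        (λ (_ , Q⊑R) Q⋢J → Q⋢J λ p → R⊑J (Q⊑R p)) T

      simple′ : ∀ x x∉K → Any (_⊑ join x x∉K) T′ →
                ∀ R → R ∈ join x x∉K ∖ K → multiplicity T′ R ≡ 1
      simple′ x x∉K any R R∈@(R⊑ , R⋢K) = trans (multiplicity-outside R⋢J)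
        (simple x x∉K (Any-filter⁻ any) R R∈)
        where
        -- Otherwise R, lying outside `K` in both joins, would force the new join into J, together
        -- with its point Q of `T′`, which avoids J.
        R⋢J : ¬ R ⊑ J
        R⋢J R⊑J with Q , Q∈T′ , Q⊑ ← find any = proj₂ (∈-filter⁻ ⋢J? {xs = T} Q∈T′)
          (join-⊑ {x = x} {x∉K} J (R⊑ (generator-member R)) (λ R∈K → R⋢K (⊑-intro R K R∈K))
            (R⊑J (generator-member R)) K⊑J ∘ Q⊑)
        Any-filter⁻ : Any (_⊑ join x x∉K) T′ → Any (_⊑ join x x∉K) T
        Any-filter⁻ any with Q , Q∈T′ , Q⊑ ← find any =
          lose (proj₁ (∈-filter⁻ ⋢J? {xs = T} Q∈T′)) Q⊑

      rest = partition n T′ length′ (filter⁺ ⋢J? T∩K≡∅) simple′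

      L : Fin (suc n) → Space (suc r)
      L zero    = J
      L (suc i) = proj₁ rest i

      K⊑L : ∀ i → K ⊑ L i
      K⊑L zero    = K⊑J
      K⊑L (suc i) = proj₁ (proj₂ rest) i

      split : ∀ R → multiplicity T R ≡ ind (R ∈? J ∖ K) ℕ.+ multiplicity T′ R
      split R = case R ⊑? J of λ where
        (no R⋢J)  → trans (sym (multiplicity-outside R⋢J))
          (cong (ℕ._+ multiplicity T′ R) (sym (ind-no (R ∈? J ∖ K) (R⋢J ∘ proj₁))))
        (yes R⊑J) → case R ⊑? K of λ where
          (yes R⊑K) → trans (cong length (filter-none (R ≈?_)
              (ListAll.map (λ Q⋢K (_ , Q⊑R) → Q⋢K λ p → R⊑K (Q⊑R p)) T∩K≡∅)))
            (sym (cong₂ ℕ._+_ (ind-no (R ∈? J ∖ K) (λ (_ , R⋢K) → R⋢K R⊑K)) (multiplicity-inside R⊑J)))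
          (no R⋢K)  → trans (simpleJ R (R⊑J , R⋢K))
            (sym (cong₂ ℕ._+_ (ind-yes (R ∈? J ∖ K) (R⊑J , R⋢K)) (multiplicity-inside R⊑J)))

      count : ∀ R → multiplicity T R ≡ ∑[ i < suc n ] ind (R ∈? L i ∖ K)
      count R = trans (split R) (cong (ind (R ∈? J ∖ K) ℕ.+_) (proj₂ (proj₂ rest) R))

  multiplicity-set : ∀ {S : Multiset} {P} → IsSet S → P ∈ₚ S → multiplicity S P ≡ 1
  multiplicity-set {Q ∷ S} {P} (Q∉S AllPairs.∷ _) (here P≈Q) = begin
    multiplicity (Q ∷ S) P      ≡⟨ cong length (filter-accept (P ≈?_) {xs = S} P≈Q) ⟩
    suc (multiplicity S P)      ≡⟨ cong (suc ∘ length) (filter-none (P ≈?_) (ListAll.map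
                                     (λ {R} Q≉R P≈R → Q≉R (≈-trans {Q} {P} {R} (≈-sym {P} {Q} P≈Q) P≈R)) Q∉S)) ⟩
    1                           ∎
    where open ≡-Reasoning
  multiplicity-set {Q ∷ S} {P} (Q∉S AllPairs.∷ S-set) (there P∈S) = trans
    (cong length (filter-reject (P ≈?_) {xs = S} λ P≈Q → All¬⇒¬Any Q∉S
      (ListAny.map (λ {R} → ≈-trans {Q} {P} {R} (≈-sym {P} {Q} P≈Q)) P∈S)))
    (multiplicity-set S-set P∈S)

  -- Divisible sets containing an affine space

  module Cylinder (r : ℕ) (S : Multiset) (S-set : IsSet S) (length-S : length S ≡ q ^ suc r)
    (divisible : Divisible (q ^ r) S) (L : Space (suc r)) (K : Space r) (K⊑L : K ⊑ L)
    (L∖K⊆S : ∀ P → P ∈ L ∖ K → P ∈ₚ S) where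

    open Join K

    private
      instance
        q^r-nonZero : NonZero (q ^ r)
        q^r-nonZero = ℕ.m^n≢0 q r

    ¬All⇒∃¬ : ∀ {p p′} {P : Pred Vector p} {Q : Pred Vector p′} → Decidable P →
      ∀ {n} {xs : Vec Vector n} → All Q xs → ¬ All P xs → ∃ λ x → Q x × ¬ P x
    ¬All⇒∃¬ P? {xs = []}     []       ¬all = contradiction [] ¬all
    ¬All⇒∃¬ P? {xs = x ∷ xs} (Qx ∷ Qxs) ¬all with P? x
    ... | yes Px = ¬All⇒∃¬ P? Qxs (¬all ∘ (Px ∷_))
    ... | no ¬Px = x , Qx , ¬Px

    apex : ∃ λ x → x ∈ Space.Member L × ¬ x ∈ Space.Member K
    apex = ¬All⇒∃¬ (member? K) (Space.contained L) λ all →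
      ℕ.1+n≰n (⊑⇒≤-dimension L K λ {x} x∈L → in-K all x∈L)
      where
      in-K : All (Space.Member K) (Space.vectors L) → L ⊑ K
      in-K all x∈L with as , refl ← Space.spanning L x∈L = linearCombination-closed K as all

    -- Take y in `L` outside `K` and e in `K` with h ∙ e nonzero, and subtract from y the multiple
    -- (h ∙ y) / (h ∙ e) of e. The class modulo `K` is unchanged, so the result stays outside `K`.
    affine-zero : ∀ h → ¬ h ⊥ Space.vectors K → ∃ λ P → P ∈ L ∖ K × h ∙ generator P ≡ 0#
    affine-zero h ¬h⊥K =
      let y , y∈L , y∉K = apex
          e , e∈K , he≢0 = ¬All⇒∃¬ (λ x → h ∙ x ≟ 0#) (Space.contained K) ¬h⊥K
          b , heb≡1 = inverse (h ∙ e) he≢0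
      in shear y y∈L y∉K e e∈K b heb≡1
      where
      shear : ∀ y → y ∈ Space.Member L → ¬ y ∈ Space.Member K →
              ∀ e → e ∈ Space.Member K → ∀ b → h ∙ e * b ≡ 1# →
              ∃ λ P → P ∈ L ∖ K × h ∙ generator P ≡ 0#
      shear y y∈L y∉K e e∈K b heb≡1 = P , (⊑-intro P L z∈L , P⋢K) , hz≡0
        where
        open ≡-Reasoning
        c = h ∙ y * b
        z = y +ⱽ - c ·ⱽ e

        z∈L : z ∈ Space.Member L
        z∈L = Space.+-closed L y∈L (Space.·-closed L (- c) (K⊑L e∈K))

        z∉K : ¬ z ∈ Space.Member K
        z∉K z∈K = y∉K (subst (Space.Member K) (·ⱽ-cancel (-‿inverseʳ c) e y)
          (Space.+-closed K (Space.·-closed K c e∈K) z∈K))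

        P : Point
        P = point z λ eq → z∉K (subst (Space.Member K) (sym eq) (Space.0-closed K))

        P⋢K : ¬ P ⊑ K
        P⋢K P⊑K = z∉K (P⊑K (generator-member P))

        hz≡0 : h ∙ z ≡ 0#
        hz≡0 = begin
          h ∙ z                       ≡⟨ trans (∙-+ʳ h y _) (cong (h ∙ y +_) (∙-·ʳ h (- c) e)) ⟩
          h ∙ y + - c * h ∙ e         ≡⟨ cong (h ∙ y +_) (sym (-‿distribˡ-* c _)) ⟩
          h ∙ y + - (c * h ∙ e)       ≡⟨ cong (λ s → h ∙ y + - s) (trans (*-assoc (h ∙ y) b _)
                                           (trans (cong (h ∙ y *_) (trans (*-comm b _) heb≡1)) (*-identityʳ _))) ⟩
          h ∙ y + - (h ∙ y)           ≡⟨ -‿inverseʳ _ ⟩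
          0#                          ∎

    ≡[mod]⇒∣ : ∀ {a b m} → a ≤ b → m ∣ b → a ≡ b [mod m ] → m ∣ a
    ≡[mod]⇒∣ {a} {b} {m} a≤b m∣b m∣∣a-b∣ =
      ∣m+n∣m⇒∣n (subst (m ∣_) (sym (ℕ.m∸n+n≡m a≤b)) m∣b)
        (subst (m ∣_) (ℕ.m≤n⇒∣m-n∣≡n∸m a≤b) m∣∣a-b∣)

    q^r≤incidence : ∀ h → ¬ h ⊥ Space.vectors K → q ^ r ≤ incidence (generators S) h
    q^r≤incidence h ¬h⊥K =
      -- A functional that does not vanish on `K` is nonzero, so its kernel is a hyperplane and
      -- `divisible` applies.
      let k , 1+k≡v , H , H≡ker = kernel h (λ h≡0 → ¬h⊥K (All.universal
            (λ x → trans (cong (_∙ x) h≡0) (∙-zeroˡ x)) _))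
          P , P∈L∖K , hP≡0 = affine-zero h ¬h⊥K
          nonempty : 0 ℕ.< ∣ S ∩ H ∣
          nonempty = filter-some (_⊑? H) (ListAny.map {Q = _⊑ H}
            (λ {Q} (_ , Q⊑P) p → ⊑-intro P H (proj₂ (H≡ker _) hP≡0) (Q⊑P p)) (L∖K⊆S P P∈L∖K))
      in subst (q ^ r ≤_) (incidence-kernel S h H H≡ker)
        (∣⇒≤ {{ℕ.>-nonZero nonempty}} (≡[mod]⇒∣ (length-filter (_⊑? H) S)
          (subst (q ^ r ∣_) (sym length-S) (n∣m*n q)) (divisible 1+k≡v H)))

    -- `q ^ suc r` unfolds to `q * q ^ r`, so `length-S` is the required factorization with c = q^r.
    open Balanced (generators S) (generator≢0 ∘ List.lookup S) (Space.vectors K)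
      (q ^ r) length-S q^r≤incidence

    S∩K≡∅ : ListAll.All (λ P → ¬ P ⊑ K) S
    S∩K≡∅ = ListAll.tabulate λ {P} P∈S P⊑K → ∉-span (ListAny.index P∈S)
      (subst (λ P → InSpan (Space.vectors K) (generator P)) (lookup-index P∈S)
        (Space.spanning K (P⊑K (generator-member P))))

    -- A point Q of `S` in the join lies outside `K` and has multiplicity 1, as `S` is a set. A
    -- functional in K⊥ kills Q exactly when it kills `x`, and likewise for R, so
    -- `spanCount-invariant` carries the multiplicity from Q to R.
    simple : ∀ x x∉K → Any (_⊑ join x x∉K) S →
             ∀ R → R ∈ join x x∉K ∖ K → multiplicity S R ≡ 1
    simple x x∉K any R (R⊑J , R⋢K) with Q , Q∈S , Q⊑J ← find any = begin
      multiplicity S R                                   ≡⟨ multiplicity-spanCount S R ⟩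
      spanCount (generators S) (generator R ∷ [])        ≡⟨ spanCount-invariant (generator≢0 R) (generator≢0 Q)
                                                              (transfer R Q R⊑J R⋢K Q⊑J) (transfer Q R Q⊑J Q⋢K R⊑J) ⟩
      spanCount (generators S) (generator Q ∷ [])        ≡⟨ multiplicity-spanCount S Q ⟨
      multiplicity S Q
        ≡⟨ multiplicity-set S-set (ListAny.map (λ { refl → ≈-refl {Q} }) Q∈S) ⟩
      1                                                  ∎
      where
      open ≡-Reasoning
      Q⋢K : ¬ Q ⊑ K
      Q⋢K = ListAll.lookup S∩K≡∅ Q∈S
      transfer : ∀ P P′ → P ⊑ join x x∉K → ¬ P ⊑ K → P′ ⊑ join x x∉K →
        ∀ h → h ⊥ Space.vectors K → h ∙ generator P ≡ 0# → h ∙ generator P′ ≡ 0#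
      transfer P P′ P⊑J P⋢K P′⊑J h h⊥K hP≡0 =
        ∙-join {h} {x} {x∉K} (⊥-member {h = h} K h⊥K) (P′⊑J (generator-member P′))
          (∙-join⁻ {h} {x} {x∉K} (⊥-member {h = h} K h⊥K) (P⊑J (generator-member P))
            (λ P∈K → P⋢K (⊑-intro P K P∈K)) hP≡0)

    isCylinder : IsCylinder r S
    isCylinder =
      let L′ , K⊑L′ , count = partition q S length-S S∩K≡∅ simple
      in length-S , L′ , K , K⊑L′ , λ P → trans (count P)
           (sym (length-filter-tabulate (λ i → P ∈? L′ i ∖ K) (λ i → i)))

mainTheorem10 : (q : ℕ) → IsPrimePower q → (F : FiniteField q) →
    (v r : ℕ) → 1 ≤ r →
    let open ProjectiveSpace F v in
    (S : Multiset) → IsSet S → length S ≡ q ^ suc r →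
    Divisible (q ^ r) S → Spanning S →
    ContainsAffineSpace r S →
    IsCylinder r S
mainTheorem10 q _ F v r _ S S-set length-S divisible _ (L , K , K⊑L , L∖K⊆S) =
  Geometry.Cylinder.isCylinder F v r S S-set length-S divisible L K K⊑L L∖K⊆S
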